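{- Fix an integer $d\geq2$. For all $n\geq 0$ and $j\in\mathbb{Z}$, $$((d-1)n+2+(d+1)j)\,(w_{d,n},t^{ -j})=((d-1)n+2-(d+1)j)\,(w_{d,n},t^j),$$ where $(w_{d,n},t^j)$ is the coefficient of $t^j$ in $w_{d,n}$.
   Context: For $n\geq0$ let $P_{(d-1)n}$ be a strictly convex polygon with $(d-1)n+2$ vertices and a marked boundary edge $e_*$. A $d$-dissection of it is a decomposition into $n$ non-overlapping convex polygons each having $d+1$ vertices, all among the vertices of $P_{(d-1)n}$. Its checkerboard colouring colours each of these polygons black or white such that the unique polygon containing $e_*$ is black and polygons sharing an edge have different colours; let $n_b,n_w$ be the numbers of black and white polygons. Define $w_{d,n}(t)=\sum t^{n_b-n_w}\in\mathbb{N}[t,t^{ -1}]$, the sum over all $d$-dissections of $P_{(d-1)n}$, with $w_{d,0}=1$. -}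

module Defs where

open import Data.Bool using (Bool; true; false; _∧_; _∨_; not; if_then_else_; _xor_)
open import Data.Nat using (ℕ; zero; suc; _+_; _*_; _∸_; _≤ᵇ_; _<ᵇ_; _≡ᵇ_)
open import Data.Fin using (Fin; toℕ; zero; suc)
open import Data.Fin.Subset using (Subset; ∣_∣)
open import Data.Vec using (Vec; []; _∷_; lookup)
open import Data.List using (List; []; _∷_; map; concatMap; length; allFin; all; any; filterᵇ; cartesianProduct)
open import Data.Product using (_×_; _,_)
open import Data.Integer as ℤ using (ℤ; _⊖_)
open import Relation.Nullary.Decidable using (does)

-- Conventions.  The polygon P_{(d-1)n} has N = (d-1)n+2 vertices, labelled
-- 0,1,…,N-1 in cyclic (counterclockwise) order around the boundary.  The marked
-- boundary edge e_* is the edge {0,1}.  A convex polygon with vertices among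
-- those of P is given by its vertex set, a 'Subset N'.

nVert : ℕ → ℕ → ℕ
nVert d n = 2 + (d ∸ 1) * n

module _ {N : ℕ} where

  _∈ᵇ_ : Fin N → Subset N → Bool
  x ∈ᵇ p = lookup p x

  inClosedArc : Fin N → Fin N → Fin N → Bool
  inClosedArc a b x =
    if toℕ a ≤ᵇ toℕ b
    then (toℕ a ≤ᵇ toℕ x) ∧ (toℕ x ≤ᵇ toℕ b)
    else (toℕ a ≤ᵇ toℕ x) ∨ (toℕ x ≤ᵇ toℕ b)

  inOpenArc : Fin N → Fin N → Fin N → Bool
  inOpenArc a b x =
    if toℕ a ≤ᵇ toℕ b
    then (toℕ a <ᵇ toℕ x) ∧ (toℕ x <ᵇ toℕ b)
    else (toℕ a <ᵇ toℕ x) ∨ (toℕ x <ᵇ toℕ b)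

  distinct : Fin N → Fin N → Bool
  distinct a b = not (toℕ a ≡ᵇ toℕ b)

  consecutive : Subset N → Fin N → Fin N → Bool
  consecutive p a b =
    distinct a b ∧ (a ∈ᵇ p) ∧ (b ∈ᵇ p)
      ∧ all (λ x → not ((x ∈ᵇ p) ∧ inOpenArc a b x)) (allFin N)

  isEdge : Subset N → Fin N → Fin N → Bool
  isEdge p a b = consecutive p a b ∨ consecutive p b a

  -- The polygons p and q (vertices in convex position, ≥ 3 vertices each) have
  -- disjoint interiors iff all vertices of q lie in the closed arc cut off by
  -- some edge of p (the "pocket" of P outside p beyond that edge).
  nonOverlapping : Subset N → Subset N → Bool
  nonOverlapping p q =
    any (λ a → any (λ b → consecutive p a b
          ∧ all (λ x → not (x ∈ᵇ q) ∨ inClosedArc a b x) (allFin N)) (allFin N)) (allFin N)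

  shareEdge : Subset N → Subset N → Bool
  shareEdge p q =
    any (λ a → any (λ b → isEdge p a b ∧ isEdge q a b) (allFin N)) (allFin N)

containsMarked : {M : ℕ} → Subset (suc (suc M)) → Bool
containsMarked p = (zero ∈ᵇ p) ∧ (suc zero ∈ᵇ p)

-- strict lexicographic order on subsets (as Boolean vectors, false < true);
-- used only to pick one canonical ordering of the (unordered) set of polygons
lexLt : {m : ℕ} → Vec Bool m → Vec Bool m → Bool
lexLt []       []       = false
lexLt (x ∷ xs) (y ∷ ys) = (not x ∧ y) ∨ (not (x xor y) ∧ lexLt xs ys)

pairsLt : (n : ℕ) → List (Fin n × Fin n)
pairsLt n = filterᵇ (λ { (i , j) → toℕ i <ᵇ toℕ j }) (cartesianProduct (allFin n) (allFin n))

vecsOf : {A : Set} → List A → (m : ℕ) → List (Vec A m)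
vecsOf xs zero    = [] ∷ []
vecsOf xs (suc m) = concatMap (λ x → map (x ∷_) (vecsOf xs m)) xs

bools : List Bool
bools = true ∷ false ∷ []

-- A candidate: n polygons (listed in strictly increasing lexicographic order, so
-- each set of polygons is listed exactly once) together with a colouring
-- (true = black, false = white) of the i-th polygon.
Candidate : ℕ → ℕ → Set
Candidate d n = Vec (Subset (nVert d n)) n × Vec Bool n

candidates : (d n : ℕ) → List (Candidate d n)
candidates d n = cartesianProduct (vecsOf (vecsOf bools (nVert d n)) n) (vecsOf bools n)

-- the polygons form a d-dissection of P_{(d-1)n}: n pairwise distinct
-- (d+1)-gons with vertices among those of P and pairwise disjoint interiors
-- (for n such polygons this forces them to cover P)
isDissection : (d n : ℕ) → Vec (Subset (nVert d n)) n → Bool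
isDissection d n ps =
  all (λ i → ∣ lookup ps i ∣ ≡ᵇ suc d) (allFin n)
  ∧ all (λ { (i , j) → lexLt (lookup ps i) (lookup ps j)
                     ∧ nonOverlapping (lookup ps i) (lookup ps j) }) (pairsLt n)

isCheckerboard : (d n : ℕ) → Vec (Subset (nVert d n)) n → Vec Bool n → Bool
isCheckerboard d n ps c =
  all (λ i → not (containsMarked (lookup ps i)) ∨ lookup c i) (allFin n)
  ∧ all (λ { (i , j) → not (shareEdge (lookup ps i) (lookup ps j))
                     ∨ (lookup c i xor lookup c j) }) (pairsLt n)

numBlack : {n : ℕ} → Vec Bool n → ℕ
numBlack []            = 0
numBlack (true  ∷ c)   = suc (numBlack c)
numBlack (false ∷ c)   = numBlack c

numWhite : {n : ℕ} → Vec Bool n → ℕ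
numWhite []            = 0
numWhite (true  ∷ c)   = numWhite c
numWhite (false ∷ c)   = suc (numWhite c)

blackMinusWhite : {n : ℕ} → Vec Bool n → ℤ
blackMinusWhite c = numBlack c ⊖ numWhite c

coeff : (d n : ℕ) → ℤ → ℕ
coeff d n j = length (filterᵇ
  (λ { (ps , c) → isDissection d n ps ∧ isCheckerboard d n ps c
                  ∧ does (blackMinusWhite c ℤ.≟ j) })
  (candidates d n))

{-# OPTIONS --safe #-}
-- Fix n ≥ 1 and count, over all properly two-coloured dissections with j more
-- black than white polygons (no condition on the marked edge), the black minus
-- the white boundary edges of the polygon.  In one such dissection every
-- interior diagonal borders a black and a white polygon, so the difference is
-- (d + 1) j.  On the other hand, rotating the polygon shows that every boundary
-- edge is black in (w, t^j) of them, and white in (w, t^-j) of them by swapping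
-- the colours.  Hence, with N = (d - 1) n + 2,
--   N ((w, t^j) - (w, t^-j)) = (d + 1) j ((w, t^j) + (w, t^-j)).
--
-- That n pairwise non-overlapping (d + 1)-gons leave no gap is a pigeonhole
-- argument.  Fix a boundary edge e.  Each polygon P has d - 1 vertices at which
-- its angle contains the direction towards e (all but the first and the last
-- vertex of P, counted from e).  These vertices are distinct for
-- non-overlapping polygons and are not endpoints of e, so all N - 2 = n (d - 1)
-- candidates occur.
module Submission where

open import Defs
open import Data.Bool as Bool using (Bool; true; false; T; not; _∧_; _∨_; _xor_)
open import Data.Bool.ListAction using (all; any)
open import Data.Bool.Properties using (T?; T-≡; T-∧; T-∨; not-injective)
open import Data.Empty using (⊥-elim)
open import Data.Fin as Fin using (Fin; zero; suc; toℕ)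
open import Data.Fin.Induction using (<-weakInduction; >-weakInduction)
import Data.Fin.Properties as Finₚ
open import Data.Fin.Relation.Unary.Top using (view; view-inject₁; view-fromℕ; ‵fromℕ; ‵inject₁)
open import Data.Fin.Subset using (Subset; ∣_∣)
open import Data.Integer as ℤ using (ℤ; +_; _+_; _-_; _*_; -_; _⊖_; 0ℤ; 1ℤ; -1ℤ)
open import Data.Integer using () renaming (_+_ to _+ℤ_; _*_ to _*ℤ_; -_ to -ℤ_; _-_ to _-ℤ_)
import Data.Integer.Properties as ℤₚ
open import Data.Integer.Tactic.RingSolver using (solve-∀)
open import Data.List as List using (List; []; _∷_; _++_; length; map; allFin; filterᵇ; cartesianProductWith)
open import Data.List.Membership.Propositional using (_∈_; _∉_)
import Data.List.Membership.Propositional.Properties as ∈ₚ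
import Data.List.Properties as Listₚ
open import Data.List.Relation.Binary.Subset.Propositional using (_⊆_)
open import Data.List.Relation.Unary.All as All using (All; []; _∷_)
import Data.List.Relation.Unary.All.Properties as Allₚ
open import Data.List.Relation.Unary.AllPairs using ([]; _∷_)
open import Data.List.Relation.Unary.Any as Any using (here; there)
import Data.List.Relation.Unary.Any.Properties as Anyₚ
open import Data.List.Relation.Unary.Unique.Propositional using (Unique)
import Data.List.Relation.Unary.Unique.Propositional.Properties as Uniqueₚ
open import Data.Nat as ℕ using (ℕ; zero; suc; _≤_; _<_; z≤n; s≤s)
import Data.Nat.Properties as ℕₚ
open import Data.List.Extrema ℕₚ.≤-totalOrder
  using (argmin; argmin-all; f[argmin]≤f[xs]; argmax; argmax-all; f[xs]≤f[argmax])
open import Data.Product using (_×_; _,_; proj₁; proj₂; ∃; ∃₂)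
open import Data.Sum as Sum using (_⊎_; inj₁; inj₂; [_,_]′)
open import Data.Unit using (tt)
open import Data.Vec as Vec using (Vec; []; _∷_; lookup)
open import Data.Vec.Membership.Propositional using () renaming (_∈_ to _∈ⱽ_)
import Data.Vec.Membership.Propositional.Properties as ∈Vecₚ
import Data.Vec.Properties as Vecₚ
open import Data.Vec.Relation.Unary.All as VAll using ([]; _∷_) renaming (All to AllV)
import Data.Vec.Relation.Unary.All.Properties as VAllₚ
open import Data.Vec.Relation.Unary.AllPairs as VAllPairs using ([]; _∷_) renaming (AllPairs to AllPairsV)
import Data.Vec.Relation.Unary.AllPairs.Properties as VAllPairsₚ
open import Data.Vec.Relation.Unary.Any using (here; there)
open import Function using (_∘_; id; Equivalence; case_of_)
open import Relation.Binary.Definitions using (tri<; tri≈; tri>)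
open import Relation.Binary.PropositionalEquality
open import Relation.Nullary using (¬_; Dec; yes; no; does; contradiction; _×-dec_; ¬?; map′)

-- The definition of a dissection asks only for pairwise non-overlapping polygons, so covering must
-- be proved before a boundary edge can be said to have a colour. The marked-edge condition is
-- replaced by one for a variable edge from `a` to `next a` and either colour; the coefficients
-- sought are the black counts at `zero`. Dissections are enumerated as lexicographically sorted
-- vectors. Rotation destroys this order, so a rotated vector is sorted again. No inverse is
-- constructed: rotation injects the dissections counted at `next a` into those counted at `a`, and
-- these inequalities close up around the polygon. Sides are directed, and the two polygons along a
-- diagonal traverse it in opposite directions, so their colours cancel only in a sum over both
-- orientations. Telling a boundary edge from its reverse takes at least three vertices, which is
-- why n = 0 is treated separately. With D = (d + 1) j, the balance N (x - y) = D (x + y) is a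
-- rearrangement of (N + D) y = (N - D) x.

private variable
  A B : Set
  l : ℕ

-- Finite counting

length-⊆ : {xs ys : List A} → Unique xs → xs ⊆ ys → length xs ≤ length ys
length-⊆ {xs = []} _ _ = z≤n
length-⊆ {xs = x ∷ xs} u@(_ ∷ uxs) sub with ∈ₚ.∈-∃++ (sub (here refl))
... | as , bs , refl = begin
  suc (length xs)               ≤⟨ s≤s (length-⊆ uxs sub′) ⟩
  suc (length (as ++ bs))       ≡⟨ cong suc (Listₚ.length-++ as) ⟩
  suc (length as ℕ.+ length bs) ≡⟨ ℕₚ.+-suc (length as) (length bs) ⟨
  length as ℕ.+ suc (length bs) ≡⟨ Listₚ.length-++ as ⟨
  length (as ++ x ∷ bs)         ∎
  where
  open ℕₚ.≤-Reasoning
  sub′ : xs ⊆ as ++ bs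
  sub′ {y} y∈xs with ∈ₚ.∈-++⁻ as (sub (there y∈xs))
  ... | inj₁ y∈as            = ∈ₚ.∈-++⁺ˡ y∈as
  ... | inj₂ (here refl)     = contradiction y∈xs (Uniqueₚ.Unique[x∷xs]⇒x∉xs u)
  ... | inj₂ (there y∈bs)    = ∈ₚ.∈-++⁺ʳ as y∈bs

-- A missing `y` could be put in front of `xs`, and the longer duplicate-free list would no longer
-- fit into `ys`. This is the pigeonhole step of the covering argument.
length-⊆-full : (∀ (x y : A) → Dec (x ≡ y)) → {xs ys : List A} →
  Unique xs → xs ⊆ ys → length ys ≤ length xs → ys ⊆ xs
length-⊆-full _≟_ {xs} {ys} u sub le {y} y∈ys with Any.any? (y ≟_) xs
... | yes y∈xs = y∈xs
... | no y∉xs  = contradiction (ℕₚ.≤-trans (length-⊆ (Allₚ.¬Any⇒All¬ xs y∉xs ∷ u) sub′) le) ℕₚ.1+n≰n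
  where
  sub′ : y ∷ xs ⊆ ys
  sub′ (here refl) = y∈ys
  sub′ (there z∈)  = sub z∈

∈-filterᵇ⁺ : (P : A → Bool) {xs : List A} {x : A} → x ∈ xs → T (P x) → x ∈ filterᵇ P xs
∈-filterᵇ⁺ P = ∈ₚ.∈-filter⁺ (T? ∘ P)

∈-filterᵇ⁻ : (P : A → Bool) {xs : List A} {x : A} → x ∈ filterᵇ P xs → x ∈ xs × T (P x)
∈-filterᵇ⁻ P {xs} = ∈ₚ.∈-filter⁻ (T? ∘ P) {xs = xs}

unique-filterᵇ : (P : A → Bool) {xs : List A} → Unique xs → Unique (filterᵇ P xs)
unique-filterᵇ P = Uniqueₚ.filter⁺ (T? ∘ P)

unique-map-on : (f : A → B) {xs : List A} → (∀ {x y} → x ∈ xs → y ∈ xs → f x ≡ f y → x ≡ y) →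
  Unique xs → Unique (map f xs)
unique-map-on f {[]} inj [] = []
unique-map-on f {x ∷ xs} inj (x∉ ∷ u) =
  Allₚ.map⁺ (All.tabulate λ y∈ eq → All.lookup x∉ y∈ (inj (here refl) (there y∈) eq))
  ∷ unique-map-on f (λ x∈ y∈ → inj (there x∈) (there y∈)) u

-- The image of the filtered list is duplicate-free and contained in the other filtered list.
-- Injectivity is required only where `P` holds, because rotation followed by sorting is injective
-- only on genuine dissections.
count-injection : {xs ys : List A} (P Q : A → Bool) (f : A → A) → Unique xs → (∀ x → x ∈ ys) →
  (∀ x → T (P x) → T (Q (f x))) → (∀ x y → T (P x) → T (P y) → f x ≡ f y → x ≡ y) →
  length (filterᵇ P xs) ≤ length (filterᵇ Q ys)
count-injection {xs = xs} {ys} P Q f u full pres inj = begin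
  length (filterᵇ P xs)         ≡⟨ Listₚ.length-map f (filterᵇ P xs) ⟨
  length (map f (filterᵇ P xs)) ≤⟨ length-⊆ (unique-map-on f inj′ (unique-filterᵇ P u)) sub ⟩
  length (filterᵇ Q ys)         ∎
  where
  open ℕₚ.≤-Reasoning
  inj′ : ∀ {x y} → x ∈ filterᵇ P xs → y ∈ filterᵇ P xs → f x ≡ f y → x ≡ y
  inj′ {x} {y} x∈ y∈ = inj x y (proj₂ (∈-filterᵇ⁻ P {xs} x∈)) (proj₂ (∈-filterᵇ⁻ P {xs} y∈))
  sub : map f (filterᵇ P xs) ⊆ filterᵇ Q ys
  sub y∈ with ∈ₚ.∈-map⁻ f y∈
  ... | x , x∈ , refl = ∈-filterᵇ⁺ Q (full (f x)) (pres x (proj₂ (∈-filterᵇ⁻ P {xs} x∈)))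

-- Brings the enumeration into the form of a product, for which uniqueness and membership are known.
vecsOf-suc : (xs : List A) (m : ℕ) → vecsOf xs (suc m) ≡ cartesianProductWith _∷_ xs (vecsOf xs m)
vecsOf-suc {A = A} xs m = go xs
  where
  go : (zs : List A) → List.concatMap (λ x → map (x ∷_) (vecsOf xs m)) zs ≡ cartesianProductWith _∷_ zs (vecsOf xs m)
  go []       = refl
  go (z ∷ zs) = cong (map (z ∷_) (vecsOf xs m) ++_) (go zs)

vecsOf-unique : {xs : List A} → Unique xs → ∀ m → Unique (vecsOf xs m)
vecsOf-unique u zero = [] ∷ []
vecsOf-unique {xs = xs} u (suc m) = subst Unique (sym (vecsOf-suc xs m))
  (Uniqueₚ.cartesianProductWith⁺ _∷_ Vecₚ.∷-injective u (vecsOf-unique u m))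

vecsOf-complete : {xs : List A} → (∀ x → x ∈ xs) → ∀ {m} (v : Vec A m) → v ∈ vecsOf xs m
vecsOf-complete full [] = here refl
vecsOf-complete {xs = xs} full {suc m} (x ∷ v) = subst (x ∷ v ∈_) (sym (vecsOf-suc xs m))
  (∈ₚ.∈-cartesianProductWith⁺ _∷_ (full x) (vecsOf-complete full v))

bools-unique : Unique bools
bools-unique = ((λ ()) ∷ []) ∷ [] ∷ []

bools-complete : ∀ b → b ∈ bools
bools-complete true  = here refl
bools-complete false = there (here refl)

candidates-unique : ∀ d n → Unique (candidates d n)
candidates-unique d n = Uniqueₚ.cartesianProduct⁺
  (vecsOf-unique (vecsOf-unique bools-unique _) n) (vecsOf-unique bools-unique n)

candidates-complete : ∀ d n (x : Candidate d n) → x ∈ candidates d n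
candidates-complete d n (ps , c) = ∈ₚ.∈-cartesianProduct⁺
  (vecsOf-complete (vecsOf-complete bools-complete) ps) (vecsOf-complete bools-complete c)

-- Sums of integers over lists

∑ : List A → (A → ℤ) → ℤ
∑ []       f = 0ℤ
∑ (x ∷ xs) f = f x +ℤ ∑ xs f

indicator : Bool → ℤ
indicator true  = 1ℤ
indicator false = 0ℤ

∑-cong : (xs : List A) {f g : A → ℤ} → (∀ x → f x ≡ g x) → ∑ xs f ≡ ∑ xs g
∑-cong []       eq = refl
∑-cong (x ∷ xs) eq = cong₂ _+ℤ_ (eq x) (∑-cong xs eq)

∑-+ : (xs : List A) (f g : A → ℤ) → ∑ xs (λ x → f x +ℤ g x) ≡ ∑ xs f +ℤ ∑ xs g
∑-+ []       f g = refl
∑-+ (x ∷ xs) f g = trans (cong (f x +ℤ g x +ℤ_) (∑-+ xs f g)) (lem (f x) (g x) (∑ xs f) (∑ xs g))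
  where
  lem : ∀ a b c d → a +ℤ b +ℤ (c +ℤ d) ≡ a +ℤ c +ℤ (b +ℤ d)
  lem = solve-∀

∑-*ˡ : (xs : List A) (k : ℤ) (f : A → ℤ) → ∑ xs (λ x → k *ℤ f x) ≡ k *ℤ ∑ xs f
∑-*ˡ []       k f = sym (ℤₚ.*-zeroʳ k)
∑-*ˡ (x ∷ xs) k f = trans (cong (k *ℤ f x +ℤ_) (∑-*ˡ xs k f)) (sym (ℤₚ.*-distribˡ-+ k (f x) (∑ xs f)))

∑-neg : (xs : List A) (f : A → ℤ) → ∑ xs (λ x → -ℤ f x) ≡ -ℤ ∑ xs f
∑-neg []       f = refl
∑-neg (x ∷ xs) f = trans (cong (-ℤ f x +ℤ_) (∑-neg xs f)) (sym (ℤₚ.neg-distrib-+ (f x) (∑ xs f)))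

∑-zero : (xs : List A) {f : A → ℤ} → (∀ x → f x ≡ 0ℤ) → ∑ xs f ≡ 0ℤ
∑-zero []       eq = refl
∑-zero (x ∷ xs) eq = cong₂ _+ℤ_ (eq x) (∑-zero xs eq)

∑-swap : (xs : List A) (ys : List B) (f : A → B → ℤ) →
  ∑ xs (λ x → ∑ ys (f x)) ≡ ∑ ys (λ y → ∑ xs (λ x → f x y))
∑-swap []       ys f = sym (∑-zero ys (λ _ → refl))
∑-swap (x ∷ xs) ys f = trans (cong (∑ ys (f x) +ℤ_) (∑-swap xs ys f))
  (sym (∑-+ ys (f x) (λ y → ∑ xs (λ z → f z y))))

∑-const : (xs : List A) (k : ℤ) → ∑ xs (λ _ → k) ≡ + length xs *ℤ k
∑-const []       k = sym (ℤₚ.*-zeroˡ k)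
∑-const (x ∷ xs) k = trans (cong (k +ℤ_) (∑-const xs k)) (sym (ℤₚ.suc-* (+ length xs) k))

∑-map : (g : B → A) (xs : List B) (f : A → ℤ) → ∑ (map g xs) f ≡ ∑ xs (f ∘ g)
∑-map g []       f = refl
∑-map g (x ∷ xs) f = cong (f (g x) +ℤ_) (∑-map g xs f)

∑-zero-∈ : (xs : List A) {f : A → ℤ} → (∀ {x} → x ∈ xs → f x ≡ 0ℤ) → ∑ xs f ≡ 0ℤ
∑-zero-∈ []       eq = refl
∑-zero-∈ (x ∷ xs) eq = cong₂ _+ℤ_ (eq (here refl)) (∑-zero-∈ xs (eq ∘ there))

∑-single : {xs : List A} {x : A} {f : A → ℤ} → Unique xs → x ∈ xs →
  (∀ y → y ≢ x → f y ≡ 0ℤ) → ∑ xs f ≡ f x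
∑-single {xs = _ ∷ xs} {x} {f} (x∉ ∷ u) (here refl) other =
  trans (cong (f x +ℤ_) (∑-zero-∈ xs λ y∈ → other _ λ { refl → All.lookup x∉ y∈ refl })) (ℤₚ.+-identityʳ (f x))
∑-single {xs = z ∷ xs} {x} {f} (z∉ ∷ u) (there x∈) other =
  trans (cong₂ _+ℤ_ (other z (All.lookup z∉ x∈)) (∑-single u x∈ other)) (ℤₚ.+-identityˡ (f x))

length-filterᵇ : (P : A → Bool) (xs : List A) → + length (filterᵇ P xs) ≡ ∑ xs (indicator ∘ P)
length-filterᵇ P [] = refl
length-filterᵇ P (x ∷ xs) with P x
... | true  = cong (1ℤ +ℤ_) (length-filterᵇ P xs)
... | false = trans (length-filterᵇ P xs) (sym (ℤₚ.+-identityˡ _))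

allFin-suc : ∀ n → allFin (suc n) ≡ zero ∷ map suc (allFin n)
allFin-suc n = cong (zero ∷_) (sym (Listₚ.map-tabulate id suc))

∑-allFin-suc : ∀ {n} (f : Fin (suc n) → ℤ) → ∑ (allFin (suc n)) f ≡ f zero +ℤ ∑ (allFin n) (f ∘ suc)
∑-allFin-suc {n} f = trans (cong (λ l → ∑ l f) (allFin-suc n)) (cong (f zero +ℤ_) (∑-map suc (allFin n) f))

-- The cyclic order

data Cyclic (a x b : ℕ) : Set where
  a<x<b : a < x → x < b → Cyclic a x b
  x<b<a : x < b → b < a → Cyclic a x b
  b<a<x : b < a → a < x → Cyclic a x b

-- The point x lies strictly inside the counterclockwise arc from a to b.
Cyc : {N : ℕ} → Fin N → Fin N → Fin N → Set
Cyc a x b = Cyclic (toℕ a) (toℕ x) (toℕ b)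

module _ {N : ℕ} where

  cyc-rotate : {a x b : Fin N} → Cyc a x b → Cyc x b a
  cyc-rotate (a<x<b p q) = b<a<x p q
  cyc-rotate (x<b<a p q) = a<x<b p q
  cyc-rotate (b<a<x p q) = x<b<a p q

  -- Abstract, so that unification can read a and x off dist a x.
  abstract
    dist : Fin N → Fin N → ℕ
    dist a x with toℕ a ℕ.≤? toℕ x
    ... | yes _ = toℕ x ℕ.∸ toℕ a
    ... | no  _ = (toℕ x ℕ.+ N) ℕ.∸ toℕ a

    dist-≤ : (a x : Fin N) → toℕ a ≤ toℕ x → dist a x ≡ toℕ x ℕ.∸ toℕ a
    dist-≤ a x p with toℕ a ℕ.≤? toℕ x
    ... | yes _ = refl
    ... | no ¬p = contradiction p ¬p

    dist-> : (a x : Fin N) → toℕ x < toℕ a → dist a x ≡ (toℕ x ℕ.+ N) ℕ.∸ toℕ a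
    dist-> a x p with toℕ a ℕ.≤? toℕ x
    ... | yes q = contradiction q (ℕₚ.<⇒≱ p)
    ... | no _  = refl

  private
    wrap : (a x b : Fin N) → toℕ a ≤ toℕ x → toℕ b < toℕ a → dist a x < dist a b
    wrap a x b p q rewrite dist-≤ a x p | dist-> a b q =
      ℕₚ.∸-monoˡ-< (ℕₚ.<-≤-trans (Finₚ.toℕ<n x) (ℕₚ.m≤n+m N (toℕ b))) p

    dist-mono : (a x b : Fin N) → toℕ a ≤ toℕ x → toℕ x < toℕ b → dist a x < dist a b
    dist-mono a x b p q rewrite dist-≤ a x p | dist-≤ a b (ℕₚ.≤-trans p (ℕₚ.<⇒≤ q)) = ℕₚ.∸-monoˡ-< q p

    dist-mono-wrapped : (a x b : Fin N) → toℕ x < toℕ b → toℕ b < toℕ a → dist a x < dist a b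
    dist-mono-wrapped a x b p q rewrite dist-> a x (ℕₚ.<-trans p q) | dist-> a b q =
      ℕₚ.∸-monoˡ-< (ℕₚ.+-monoˡ-< N p) (ℕₚ.≤-trans (ℕₚ.<⇒≤ (Finₚ.toℕ<n a)) (ℕₚ.m≤n+m N (toℕ x)))

  dist-self : (a : Fin N) → dist a a ≡ 0
  dist-self a = trans (dist-≤ a a ℕₚ.≤-refl) (ℕₚ.n∸n≡0 (toℕ a))

  dist-positive : {a x : Fin N} → a ≢ x → 0 < dist a x
  dist-positive {a} {x} a≢x with ℕₚ.<-cmp (toℕ a) (toℕ x)
  ... | tri< p _ _ = subst (_< dist a x) (dist-self a) (dist-mono a a x ℕₚ.≤-refl p)
  ... | tri≈ _ p _ = contradiction (Finₚ.toℕ-injective p) a≢x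
  ... | tri> _ _ p = subst (_< dist a x) (dist-self a) (wrap a a x ℕₚ.≤-refl p)

  cyc⇒dist : {a x b : Fin N} → Cyc a x b → dist a x < dist a b
  cyc⇒dist {a} {x} {b} (a<x<b p q) = dist-mono a x b (ℕₚ.<⇒≤ p) q
  cyc⇒dist {a} {x} {b} (x<b<a p q) = dist-mono-wrapped a x b p q
  cyc⇒dist {a} {x} {b} (b<a<x p q) = wrap a x b (ℕₚ.<⇒≤ q) p

  cyc-distinct : {a x b : Fin N} → Cyc a x b → a ≢ x × x ≢ b × a ≢ b
  cyc-distinct (a<x<b p q) = (λ { refl → ℕₚ.<-irrefl refl p }) , (λ { refl → ℕₚ.<-irrefl refl q })
                           , (λ { refl → ℕₚ.<-asym p q })
  cyc-distinct (x<b<a p q) = (λ { refl → ℕₚ.<-asym p q }) , (λ { refl → ℕₚ.<-irrefl refl p })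
                           , (λ { refl → ℕₚ.<-irrefl refl q })
  cyc-distinct (b<a<x p q) = (λ { refl → ℕₚ.<-irrefl refl q }) , (λ { refl → ℕₚ.<-asym p q })
                           , (λ { refl → ℕₚ.<-irrefl refl p })

  cyc-total : {a x b : Fin N} → a ≢ x → x ≢ b → a ≢ b → Cyc a x b ⊎ Cyc a b x
  cyc-total {a} {x} {b} a≢x x≢b a≢b
    with ℕₚ.<-cmp (toℕ a) (toℕ x) | ℕₚ.<-cmp (toℕ x) (toℕ b) | ℕₚ.<-cmp (toℕ a) (toℕ b)
  ... | tri≈ _ p _ | _ | _ = contradiction (Finₚ.toℕ-injective p) a≢x
  ... | _ | tri≈ _ p _ | _ = contradiction (Finₚ.toℕ-injective p) x≢b
  ... | _ | _ | tri≈ _ p _ = contradiction (Finₚ.toℕ-injective p) a≢b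
  ... | tri< p _ _ | tri< q _ _ | _          = inj₁ (a<x<b p q)
  ... | tri< p _ _ | tri> _ _ q | tri< r _ _ = inj₂ (a<x<b r q)
  ... | tri< p _ _ | tri> _ _ q | tri> _ _ r = inj₁ (b<a<x r p)
  ... | tri> _ _ p | tri< q _ _ | tri< r _ _ = inj₂ (b<a<x p r)
  ... | tri> _ _ p | tri< q _ _ | tri> _ _ r = inj₁ (x<b<a q r)
  ... | tri> _ _ p | tri> _ _ q | _          = inj₂ (x<b<a q p)

  dist⇒cyc : {a x b : Fin N} → a ≢ x → dist a x < dist a b → Cyc a x b
  dist⇒cyc {a} {x} {b} a≢x lt with cyc-total a≢x
    (λ { refl → ℕₚ.<-irrefl refl lt })
    (λ { refl → ℕₚ.n≮0 (subst (dist a x <_) (dist-self a) lt) })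
  ... | inj₁ c = c
  ... | inj₂ c = contradiction (cyc⇒dist c) (ℕₚ.<-asym lt)

  dist-injective : {a x y : Fin N} → dist a x ≡ dist a y → x ≡ y
  dist-injective {a} {x} {y} eq with a Fin.≟ x | a Fin.≟ y | x Fin.≟ y
  ... | _ | _ | yes p = p
  ... | yes refl | yes refl | no q = contradiction refl q
  ... | yes refl | no q | _ = contradiction (dist-positive q) (ℕₚ.<-irrefl (trans (sym (dist-self a)) eq))
  ... | no q | yes refl | _ = contradiction (dist-positive q) (ℕₚ.<-irrefl (trans (sym (dist-self a)) (sym eq)))
  ... | no p | no q | no r with cyc-total p r q
  ...   | inj₁ c = contradiction (cyc⇒dist c) (ℕₚ.<-irrefl eq)
  ...   | inj₂ c = contradiction (cyc⇒dist c) (ℕₚ.<-irrefl (sym eq))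

  cyc-asym : {a x b : Fin N} → Cyc a x b → ¬ Cyc a b x
  cyc-asym c d = ℕₚ.<-asym (cyc⇒dist c) (cyc⇒dist d)

  cyc-trans : {a x y z : Fin N} → Cyc a x y → Cyc a y z → Cyc a x z
  cyc-trans c d = dist⇒cyc (proj₁ (cyc-distinct c)) (ℕₚ.<-trans (cyc⇒dist c) (cyc⇒dist d))

  -- Allows cyclic order to be argued linearly from any base point `a`, which may coincide with `x`
  -- but with neither of the others.
  dist⇒cyc₃ : {a x y z : Fin N} → dist a x < dist a y → dist a y < dist a z → Cyc x y z
  dist⇒cyc₃ {a} {x} {y} {z} p q with a Fin.≟ x
  ... | yes refl = dist⇒cyc (λ { refl → ℕₚ.<-irrefl refl p }) q
  ... | no a≢x = cyc-rotate (cyc-rotate (cyc-trans c₂ (cyc-rotate c₁)))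
    where
    c₁ : Cyc x y a
    c₁ = cyc-rotate (dist⇒cyc a≢x p)
    a≢y : a ≢ y
    a≢y refl = ℕₚ.n≮0 (subst (dist a x <_) (dist-self a) p)
    c₂ : Cyc y z a
    c₂ = cyc-rotate (dist⇒cyc a≢y q)

  -- `Cyc x y z` permits three linear orders from `a`, one for each rotation; the inequality between
  -- `x` and `z` selects the one that begins with `x`.
  cyc⇒dist₃ : {a x y z : Fin N} → dist a x < dist a z → Cyc x y z → dist a x < dist a y × dist a y < dist a z
  cyc⇒dist₃ {a} {x} {y} {z} p c with ℕₚ.<-cmp (dist a x) (dist a y) | ℕₚ.<-cmp (dist a y) (dist a z)
  ... | tri≈ _ q _ | _ = contradiction (dist-injective q) (proj₁ (cyc-distinct c))
  ... | _ | tri≈ _ q _ = contradiction (dist-injective q) (proj₁ (proj₂ (cyc-distinct c)))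
  ... | tri< q _ _ | tri< r _ _ = q , r
  ... | tri< q _ _ | tri> _ _ r = contradiction (dist⇒cyc₃ p r) (cyc-asym c)
  ... | tri> _ _ q | _ = contradiction (cyc-rotate (dist⇒cyc₃ q p)) (cyc-asym c)

  ClosedArc : Fin N → Fin N → Fin N → Set
  ClosedArc a b x = x ≡ a ⊎ x ≡ b ⊎ Cyc a x b

-- The successor on the boundary

next : {M : ℕ} → Fin (suc M) → Fin (suc M)
next i with view i
... | ‵fromℕ     = zero
... | ‵inject₁ j = suc j

module _ {M : ℕ} where

  next-inject₁ : (j : Fin M) → next (Fin.inject₁ j) ≡ suc j
  next-inject₁ j rewrite view-inject₁ j = refl

  next-fromℕ : next (Fin.fromℕ M) ≡ zero
  next-fromℕ rewrite view-fromℕ M = refl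

  prev : Fin (suc M) → Fin (suc M)
  prev zero    = Fin.fromℕ M
  prev (suc j) = Fin.inject₁ j

  next-prev : ∀ i → next (prev i) ≡ i
  next-prev zero    = next-fromℕ
  next-prev (suc j) = next-inject₁ j

  prev-next : ∀ i → prev (next i) ≡ i
  prev-next i with view i
  ... | ‵fromℕ     = refl
  ... | ‵inject₁ j = refl

  next-injective : {i j : Fin (suc M)} → next i ≡ next j → i ≡ j
  next-injective {i} {j} eq = trans (sym (prev-next i)) (trans (cong prev eq) (prev-next j))

  private
    linear : (a x b : Fin (suc M)) → toℕ a < toℕ x → toℕ x < toℕ b → Cyc (next a) (next x) (next b)
    linear a x b p q with view a | view x | view b
    ... | ‵inject₁ i | ‵inject₁ k | ‵inject₁ l
      rewrite Finₚ.toℕ-inject₁ i | Finₚ.toℕ-inject₁ k | Finₚ.toℕ-inject₁ l = a<x<b (s≤s p) (s≤s q)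
    -- If `b` is the last vertex, its successor is 0, and the order a < x < b becomes b < a < x.
    ... | ‵inject₁ i | ‵inject₁ k | ‵fromℕ
      rewrite Finₚ.toℕ-inject₁ i | Finₚ.toℕ-inject₁ k = b<a<x (s≤s z≤n) (s≤s p)
    ... | _ | ‵fromℕ | _ = contradiction q (ℕₚ.≤⇒≯ (Finₚ.≤fromℕ b))
    ... | ‵fromℕ | _ | _ = contradiction p (ℕₚ.≤⇒≯ (Finₚ.≤fromℕ x))

  cyc-next : {a x b : Fin (suc M)} → Cyc a x b → Cyc (next a) (next x) (next b)
  cyc-next {a} {x} {b} (a<x<b p q) = linear a x b p q
  cyc-next {a} {x} {b} (x<b<a p q) = cyc-rotate (cyc-rotate (linear x b a p q))
  cyc-next {a} {x} {b} (b<a<x p q) = cyc-rotate (linear b a x p q)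

  cyc-next⁻ : {a x b : Fin (suc M)} → Cyc (next a) (next x) (next b) → Cyc a x b
  cyc-next⁻ {a} {x} {b} c with cyc-distinct c
  ... | p , q , r with cyc-total (p ∘ cong next) (q ∘ cong next) (r ∘ cong next)
  ... | inj₁ d = d
  ... | inj₂ d = contradiction (cyc-next d) (cyc-asym c)

  next-adjacent : {a x : Fin (suc M)} → ¬ Cyc a x (next a)
  next-adjacent {a} {x} c with view a
  next-adjacent {_} {x} c | ‵inject₁ j with c
  ... | a<x<b p q = ℕₚ.<⇒≱ (subst (_< toℕ x) (Finₚ.toℕ-inject₁ j) p) (ℕₚ.≤-pred q)
  ... | x<b<a p q = ℕₚ.<-asym q (s≤s (ℕₚ.≤-reflexive (Finₚ.toℕ-inject₁ j)))
  ... | b<a<x p q = ℕₚ.<-asym p (s≤s (ℕₚ.≤-reflexive (Finₚ.toℕ-inject₁ j)))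
  next-adjacent {_} {x} c | ‵fromℕ with c
  ... | a<x<b p ()
  ... | x<b<a () q
  ... | b<a<x p q = ℕₚ.<⇒≱ q (Finₚ.≤fromℕ x)

next≢ : {M : ℕ} (a : Fin (suc (suc M))) → a ≢ next a
next≢ a eq with view a
... | ‵fromℕ with () ← eq
... | ‵inject₁ j = ℕₚ.1+n≢n (trans (cong toℕ (sym eq)) (Finₚ.toℕ-inject₁ j))

toℕ-next : {M : ℕ} (a : Fin (suc M)) → toℕ (next a) ≡ suc (toℕ a) ⊎ (toℕ a ≡ M × toℕ (next a) ≡ 0)
toℕ-next {M} a with view a
... | ‵fromℕ     = inj₂ (Finₚ.toℕ-fromℕ M , refl)
... | ‵inject₁ j = inj₁ (cong suc (sym (Finₚ.toℕ-inject₁ j)))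

-- A boundary edge is not its own reverse. With two vertices this fails, since `next` is then an
-- involution.
next²≢ : {M : ℕ} (a : Fin (suc (suc (suc M)))) → a ≢ next (next a)
next²≢ a eq with toℕ-next a | toℕ-next (next a) | cong toℕ eq
... | inj₁ p       | inj₁ q       | e = ℕₚ.<-irrefl (trans e (trans q (cong suc p))) (ℕₚ.m≤n⇒m≤1+n ℕₚ.≤-refl)
... | inj₁ p       | inj₂ (q , r) | e with () ← trans (sym q) (trans p (cong suc (trans e r)))
... | inj₂ (p , r) | inj₁ q       | e with () ← trans (sym p) (trans e (trans q (cong suc r)))
... | inj₂ (p , r) | inj₂ (q , _) | e with () ← trans (sym r) q

-- Boolean tests as propositions

T-∧⁻ : {a b : Bool} → T (a ∧ b) → T a × T b
T-∧⁻ = Equivalence.to T-∧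

T-∧⁺ : {a b : Bool} → T a → T b → T (a ∧ b)
T-∧⁺ p q = Equivalence.from T-∧ (p , q)

T-∨⁻ : {a b : Bool} → T (a ∨ b) → T a ⊎ T b
T-∨⁻ = Equivalence.to T-∨

T-∨⁺ : {a b : Bool} → T a ⊎ T b → T (a ∨ b)
T-∨⁺ = Equivalence.from T-∨

T-not⁺ : {a : Bool} → ¬ T a → T (not a)
T-not⁺ {true}  p = p tt
T-not⁺ {false} p = tt

T-not⁻ : {a : Bool} → T (not a) → ¬ T a
T-not⁻ {false} _ ()

T-⇒⁺ : {a b : Bool} → (T a → T b) → T (not a ∨ b)
T-⇒⁺ {true}  f = f tt
T-⇒⁺ {false} f = tt

T-⇒⁻ : {a b : Bool} → T (not a ∨ b) → T a → T b
T-⇒⁻ {true} p _ = p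

all-allFin⁺ : {n : ℕ} {f : Fin n → Bool} → (∀ i → T (f i)) → T (all f (allFin n))
all-allFin⁺ {f = f} p = Allₚ.all⁻ f (All.tabulate {xs = allFin _} (λ {i} _ → p i))

all-allFin⁻ : {n : ℕ} {f : Fin n → Bool} → T (all f (allFin n)) → ∀ i → T (f i)
all-allFin⁻ {f = f} p i = All.lookup (Allₚ.all⁺ f (allFin _) p) (∈ₚ.∈-allFin i)

any-allFin⁺ : {n : ℕ} {f : Fin n → Bool} (i : Fin n) → T (f i) → T (any f (allFin n))
any-allFin⁺ {f = f} i p = Anyₚ.any⁺ f (Any.map (λ { refl → p }) (∈ₚ.∈-allFin i))

any-allFin⁻ : {n : ℕ} {f : Fin n → Bool} → T (any f (allFin n)) → ∃ λ i → T (f i)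
any-allFin⁻ {f = f} p = Any.satisfied (Anyₚ.any⁻ f (allFin _) p)

-- Polygons

module _ {N : ℕ} where

  openArc⁻ : {a b x : Fin N} → T (inOpenArc a b x) → Cyc a x b
  openArc⁻ {a} {b} {x} p with toℕ a ℕ.≤ᵇ toℕ b in eq
  ... | true  = a<x<b (ℕₚ.<ᵇ⇒< (toℕ a) (toℕ x) (proj₁ (T-∧⁻ p))) (ℕₚ.<ᵇ⇒< (toℕ x) (toℕ b) (proj₂ (T-∧⁻ p)))
  ... | false with T-∨⁻ p
  ...   | inj₁ q = b<a<x (ℕₚ.≰⇒> (λ r → subst T eq (ℕₚ.≤⇒≤ᵇ r))) (ℕₚ.<ᵇ⇒< (toℕ a) (toℕ x) q)
  ...   | inj₂ q = x<b<a (ℕₚ.<ᵇ⇒< (toℕ x) (toℕ b) q) (ℕₚ.≰⇒> (λ r → subst T eq (ℕₚ.≤⇒≤ᵇ r)))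

  openArc⁺ : {a b x : Fin N} → Cyc a x b → T (inOpenArc a b x)
  openArc⁺ {a} {b} {x} c with toℕ a ℕ.≤ᵇ toℕ b in eq | c
  ... | true  | a<x<b p q = T-∧⁺ (ℕₚ.<⇒<ᵇ p) (ℕₚ.<⇒<ᵇ q)
  ... | true  | x<b<a p q = contradiction q (ℕₚ.≤⇒≯ (ℕₚ.≤ᵇ⇒≤ (toℕ a) (toℕ b) (subst T (sym eq) tt)))
  ... | true  | b<a<x p q = contradiction p (ℕₚ.≤⇒≯ (ℕₚ.≤ᵇ⇒≤ (toℕ a) (toℕ b) (subst T (sym eq) tt)))
  ... | false | a<x<b p q = ⊥-elim (subst T eq (ℕₚ.≤⇒≤ᵇ (ℕₚ.<⇒≤ (ℕₚ.<-trans p q))))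
  ... | false | x<b<a p q = T-∨⁺ (inj₂ (ℕₚ.<⇒<ᵇ p))
  ... | false | b<a<x p q = T-∨⁺ (inj₁ (ℕₚ.<⇒<ᵇ q))

  closedArc⁻ : {a b x : Fin N} → T (inClosedArc a b x) → ClosedArc a b x
  closedArc⁻ {a} {b} {x} p with x Fin.≟ a | x Fin.≟ b
  ... | yes q | _     = inj₁ q
  ... | no _  | yes q = inj₂ (inj₁ q)
  ... | no q  | no r  with toℕ a ℕ.≤ᵇ toℕ b in eq
  ...   | true  = inj₂ (inj₂ (a<x<b (ℕₚ.≤∧≢⇒< (ℕₚ.≤ᵇ⇒≤ (toℕ a) (toℕ x) (proj₁ (T-∧⁻ p))) (q ∘ sym ∘ Finₚ.toℕ-injective))
                                  (ℕₚ.≤∧≢⇒< (ℕₚ.≤ᵇ⇒≤ (toℕ x) (toℕ b) (proj₂ (T-∧⁻ p))) (r ∘ Finₚ.toℕ-injective))))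
  ...   | false with T-∨⁻ p
  ...     | inj₁ s = inj₂ (inj₂ (b<a<x (ℕₚ.≰⇒> (λ r → subst T eq (ℕₚ.≤⇒≤ᵇ r)))
                       (ℕₚ.≤∧≢⇒< (ℕₚ.≤ᵇ⇒≤ (toℕ a) (toℕ x) s) (q ∘ sym ∘ Finₚ.toℕ-injective))))
  ...     | inj₂ s = inj₂ (inj₂ (x<b<a (ℕₚ.≤∧≢⇒< (ℕₚ.≤ᵇ⇒≤ (toℕ x) (toℕ b) s) (r ∘ Finₚ.toℕ-injective))
                       (ℕₚ.≰⇒> (λ r → subst T eq (ℕₚ.≤⇒≤ᵇ r)))))

  closedArc⁺ : {a b x : Fin N} → ClosedArc a b x → T (inClosedArc a b x)
  closedArc⁺ {a} {b} {x} c with toℕ a ℕ.≤ᵇ toℕ b in eq | c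
  ... | true  | inj₁ refl = T-∧⁺ (ℕₚ.≤⇒≤ᵇ (ℕₚ.≤-refl {toℕ a})) (subst T (sym eq) tt)
  ... | false | inj₁ refl = T-∨⁺ (inj₁ (ℕₚ.≤⇒≤ᵇ (ℕₚ.≤-refl {toℕ a})))
  ... | true  | inj₂ (inj₁ refl) = T-∧⁺ (subst T (sym eq) tt) (ℕₚ.≤⇒≤ᵇ (ℕₚ.≤-refl {toℕ b}))
  ... | false | inj₂ (inj₁ refl) = T-∨⁺ (inj₂ (ℕₚ.≤⇒≤ᵇ (ℕₚ.≤-refl {toℕ b})))
  ... | true  | inj₂ (inj₂ (a<x<b p q)) = T-∧⁺ (ℕₚ.≤⇒≤ᵇ (ℕₚ.<⇒≤ p)) (ℕₚ.≤⇒≤ᵇ (ℕₚ.<⇒≤ q))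
  ... | true  | inj₂ (inj₂ (x<b<a p q)) = contradiction q (ℕₚ.≤⇒≯ (ℕₚ.≤ᵇ⇒≤ (toℕ a) (toℕ b) (subst T (sym eq) tt)))
  ... | true  | inj₂ (inj₂ (b<a<x p q)) = contradiction p (ℕₚ.≤⇒≯ (ℕₚ.≤ᵇ⇒≤ (toℕ a) (toℕ b) (subst T (sym eq) tt)))
  ... | false | inj₂ (inj₂ (a<x<b p q)) = ⊥-elim (subst T eq (ℕₚ.≤⇒≤ᵇ (ℕₚ.<⇒≤ (ℕₚ.<-trans p q))))
  ... | false | inj₂ (inj₂ (x<b<a p q)) = T-∨⁺ (inj₂ (ℕₚ.≤⇒≤ᵇ (ℕₚ.<⇒≤ p)))
  ... | false | inj₂ (inj₂ (b<a<x p q)) = T-∨⁺ (inj₁ (ℕₚ.≤⇒≤ᵇ (ℕₚ.<⇒≤ q)))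

  infix 4 _∈ᵖ_

  _∈ᵖ_ : Fin N → Subset N → Set
  x ∈ᵖ p = T (x ∈ᵇ p)

  -- The directed side from a to b of a polygon traversed counterclockwise.
  record Side (p : Subset N) (a b : Fin N) : Set where
    constructor side
    field
      distinct-ends : a ≢ b
      start∈        : a ∈ᵖ p
      end∈          : b ∈ᵖ p
      nothing-between : ∀ x → x ∈ᵖ p → ¬ Cyc a x b

  open Side public

  side⁻ : {p : Subset N} {a b : Fin N} → T (consecutive p a b) → Side p a b
  side⁻ {p} {a} {b} t with T-∧⁻ {distinct a b} t
  ... | d , t₁ with T-∧⁻ {a ∈ᵇ p} t₁
  ... | a∈ , t₂ with T-∧⁻ {b ∈ᵇ p} t₂
  ... | b∈ , t₃ = side (λ { refl → T-not⁻ d (ℕₚ.≡⇒≡ᵇ (toℕ a) (toℕ a) refl) }) a∈ b∈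
    (λ x x∈ c → T-not⁻ (all-allFin⁻ t₃ x) (T-∧⁺ x∈ (openArc⁺ c)))

  side⁺ : {p : Subset N} {a b : Fin N} → Side p a b → T (consecutive p a b)
  side⁺ {p} {a} {b} (side d a∈ b∈ e) =
    T-∧⁺ {distinct a b} (T-not⁺ (d ∘ Finₚ.toℕ-injective ∘ ℕₚ.≡ᵇ⇒≡ (toℕ a) (toℕ b)))
      (T-∧⁺ {a ∈ᵇ p} a∈ (T-∧⁺ {b ∈ᵇ p} b∈ (all-allFin⁺ λ x → T-not⁺ λ t →
        e x (proj₁ (T-∧⁻ {x ∈ᵇ p} t)) (openArc⁻ (proj₂ (T-∧⁻ {x ∈ᵇ p} t))))))

  NonOverlap : Subset N → Subset N → Set
  NonOverlap p q = ∃₂ λ a b → Side p a b × (∀ x → x ∈ᵖ q → ClosedArc a b x)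

  nonOverlap⁻ : {p q : Subset N} → T (nonOverlapping p q) → NonOverlap p q
  nonOverlap⁻ {p} t with any-allFin⁻ t
  ... | a , t₁ with any-allFin⁻ t₁
  ... | b , t₂ with T-∧⁻ {consecutive p a b} t₂
  ... | s , t₃ = a , b , side⁻ s , λ x x∈ → closedArc⁻ (T-⇒⁻ (all-allFin⁻ t₃ x) x∈)

  nonOverlap⁺ : {p q : Subset N} → NonOverlap p q → T (nonOverlapping p q)
  nonOverlap⁺ {p} (a , b , s , cl) = any-allFin⁺ a (any-allFin⁺ b
    (T-∧⁺ {consecutive p a b} (side⁺ s) (all-allFin⁺ λ x → T-⇒⁺ λ x∈ → closedArc⁺ (cl x x∈))))

  ShareEdge : Subset N → Subset N → Set
  ShareEdge p q = ∃₂ λ a b → (Side p a b ⊎ Side p b a) × (Side q a b ⊎ Side q b a)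

  edge⁻ : {p : Subset N} {a b : Fin N} → T (isEdge p a b) → Side p a b ⊎ Side p b a
  edge⁻ {p} {a} {b} t with T-∨⁻ {consecutive p a b} t
  ... | inj₁ s = inj₁ (side⁻ s)
  ... | inj₂ s = inj₂ (side⁻ s)

  edge⁺ : {p : Subset N} {a b : Fin N} → Side p a b ⊎ Side p b a → T (isEdge p a b)
  edge⁺ {p} {a} {b} (inj₁ s) = T-∨⁺ {consecutive p a b} (inj₁ (side⁺ s))
  edge⁺ {p} {a} {b} (inj₂ s) = T-∨⁺ {consecutive p a b} (inj₂ (side⁺ s))

  shareEdge⁻ : {p q : Subset N} → T (shareEdge p q) → ShareEdge p q
  shareEdge⁻ {p} t with any-allFin⁻ t
  ... | a , t₁ with any-allFin⁻ t₁
  ... | b , t₂ with T-∧⁻ {isEdge p a b} t₂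
  ... | s , s′ = a , b , edge⁻ s , edge⁻ s′

  shareEdge⁺ : {p q : Subset N} → ShareEdge p q → T (shareEdge p q)
  shareEdge⁺ {p} (a , b , s , s′) = any-allFin⁺ a (any-allFin⁺ b (T-∧⁺ {isEdge p a b} (edge⁺ s) (edge⁺ s′)))

  shareEdge-sym : {p q : Subset N} → ShareEdge p q → ShareEdge q p
  shareEdge-sym (a , b , s , s′) = a , b , s′ , s

∣∣-∑ : {N : ℕ} (p : Subset N) → + ∣ p ∣ ≡ ∑ (allFin N) (indicator ∘ lookup p)
∣∣-∑ []          = refl
∣∣-∑ (true  ∷ p) = trans (cong (1ℤ +ℤ_) (∣∣-∑ p)) (sym (∑-allFin-suc (indicator ∘ lookup (true ∷ p))))
∣∣-∑ (false ∷ p) = trans (sym (trans (cong (0ℤ +ℤ_) (sym (∣∣-∑ p))) (ℤₚ.+-identityˡ _)))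
  (sym (∑-allFin-suc (indicator ∘ lookup (false ∷ p))))

module _ {N : ℕ} where

  members : Subset N → List (Fin N)
  members p = filterᵇ (lookup p) (allFin N)

  ∈-members⁻ : {p : Subset N} {x : Fin N} → x ∈ members p → x ∈ᵖ p
  ∈-members⁻ {p} x∈ = proj₂ (∈-filterᵇ⁻ (lookup p) {allFin N} x∈)

  unique-members : (p : Subset N) → Unique (members p)
  unique-members p = unique-filterᵇ (lookup p) (Uniqueₚ.allFin⁺ N)

  length-members : (p : Subset N) → length (members p) ≡ ∣ p ∣
  length-members p = ℤₚ.+-injective (trans (length-filterᵇ (lookup p) (allFin N)) (sym (∣∣-∑ p)))

  -- By pigeonhole, since otherwise all vertices of `p` would fit into `xs`. It supplies a vertex of
  -- `p` different from up to two given ones.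
  vertex-outside : (p : Subset N) (xs : List (Fin N)) → length xs < ∣ p ∣ → ∃ λ x → x ∈ᵖ p × x ∉ xs
  vertex-outside p xs lt with Finₚ.any? (λ x → T? (x ∈ᵇ p) ×-dec ¬? (Any.any? (x Fin.≟_) xs))
  ... | yes found = found
  ... | no none = contradiction (subst (_≤ length xs) (length-members p) (length-⊆ (unique-members p) sub)) (ℕₚ.<⇒≱ lt)
    where
    sub : members p ⊆ xs
    sub {x} x∈ with Any.any? (x Fin.≟_) xs
    ... | yes q = q
    ... | no q  = contradiction (x , ∈-members⁻ {p} x∈ , q) none

  minimiser : (f : Fin N → ℕ) (P : Fin N → Bool) {x₀ : Fin N} → T (P x₀) →
    ∃ λ y → T (P y) × (∀ x → T (P x) → f y ≤ f x)
  minimiser f P {x₀} Px₀ = argmin f x₀ (filterᵇ P (allFin N))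
    , argmin-all f {P = T ∘ P} Px₀ (All.tabulate λ x∈ → proj₂ (∈-filterᵇ⁻ P {allFin N} x∈))
    , λ x Px → All.lookup (f[argmin]≤f[xs] {f = f} x₀ _) (∈-filterᵇ⁺ P (∈ₚ.∈-allFin x) Px)

  maximiser : (f : Fin N → ℕ) (P : Fin N → Bool) {x₀ : Fin N} → T (P x₀) →
    ∃ λ y → T (P y) × (∀ x → T (P x) → f x ≤ f y)
  maximiser f P {x₀} Px₀ = argmax f x₀ (filterᵇ P (allFin N))
    , argmax-all f {P = T ∘ P} Px₀ (All.tabulate λ x∈ → proj₂ (∈-filterᵇ⁻ P {allFin N} x∈))
    , λ x Px → All.lookup (f[xs]≤f[argmax] {f = f} x₀ _) (∈-filterᵇ⁺ P (∈ₚ.∈-allFin x) Px)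

-- Sides of a polygon and non-overlapping pairs

module _ {N : ℕ} where

  side-end-unique : {p : Subset N} {a b b′ : Fin N} → Side p a b → Side p a b′ → b ≡ b′
  side-end-unique {b = b} {b′} (side a≢b _ b∈ e) (side a≢b′ _ b′∈ e′) with b Fin.≟ b′
  ... | yes eq = eq
  ... | no b≢b′ with cyc-total a≢b b≢b′ a≢b′
  ...   | inj₁ c = contradiction c (e′ b b∈)
  ...   | inj₂ c = contradiction c (e b′ b′∈)

  -- The end is the first vertex of `p`, other than `a`, met counterclockwise from `a`.
  side-exists : {p : Subset N} {a : Fin N} → 2 ≤ ∣ p ∣ → a ∈ᵖ p → ∃ λ b → Side p a b
  side-exists {p} {a} 2≤p a∈ with vertex-outside p (a ∷ []) 2≤p
  ... | x₀ , x₀∈ , x₀∉ with minimiser (dist a) (λ x → (x ∈ᵇ p) ∧ not (does (a Fin.≟ x)))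
                             {x₀} (T-∧⁺ x₀∈ (T-not⁺ λ t → x₀∉ (here (sym (≟-sound t)))))
    where
    ≟-sound : {x : Fin N} → T (does (a Fin.≟ x)) → a ≡ x
    ≟-sound {x} t with yes eq ← a Fin.≟ x = eq
  ... | b , Pb , least with T-∧⁻ {b ∈ᵇ p} Pb
  ... | b∈ , b≠ = b , side a≢b a∈ b∈ λ x x∈ c →
        ℕₚ.<⇒≱ (cyc⇒dist c) (least x (T-∧⁺ x∈ (T-not⁺ (≢⇒ (proj₁ (cyc-distinct c))))))
    where
    ≢⇒ : {x : Fin N} → a ≢ x → ¬ T (does (a Fin.≟ x))
    ≢⇒ {x} a≢x t with a Fin.≟ x
    ... | yes eq = a≢x eq
    a≢b : a ≢ b
    a≢b refl with a Fin.≟ a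
    ... | no q = q refl

  open-ended : {p : Subset N} {a b : Fin N} → 3 ≤ ∣ p ∣ → Side p a b → ¬ Side p b a
  open-ended {p} {a} {b} 3≤p s t with vertex-outside p (a ∷ b ∷ []) 3≤p
  ... | x , x∈ , x∉ with cyc-total (λ { refl → x∉ (here refl) }) (λ { refl → x∉ (there (here refl)) }) (distinct-ends s)
  ...   | inj₁ c = nothing-between s x x∈ c
  ...   | inj₂ c = nothing-between t x x∈ (cyc-rotate c)

  endpoint : {p : Subset N} {a b x : Fin N} → Side p a b → x ∈ᵖ p → ClosedArc a b x → x ≡ a ⊎ x ≡ b
  endpoint s x∈ (inj₁ eq)        = inj₁ eq
  endpoint s x∈ (inj₂ (inj₁ eq)) = inj₂ eq
  endpoint s x∈ (inj₂ (inj₂ c))  = contradiction c (nothing-between s _ x∈)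

  -- Since `q` lies behind the side from `x` to `y` of `p`, the common vertices `a` and `b` are the
  -- ends of that side. If its direction is from `b` to `a`, then `p` has only two vertices. If it
  -- is from `a` to `b`, a third vertex of `q` lies strictly between them, where the side of `q`
  -- allows none.
  side-not-shared : {p q : Subset N} {a b : Fin N} → 3 ≤ ∣ p ∣ → 3 ≤ ∣ q ∣ →
    NonOverlap p q → Side p a b → ¬ Side q a b
  side-not-shared {p} {q} {a} {b} 3≤p 3≤q (x , y , s , cl) sp sq
    with endpoint s (start∈ sp) (cl a (start∈ sq)) | endpoint s (end∈ sp) (cl b (end∈ sq))
  ... | inj₁ refl | inj₁ refl = distinct-ends sp refl
  ... | inj₂ refl | inj₂ refl = distinct-ends sp refl
  ... | inj₂ refl | inj₁ refl = open-ended 3≤p sp s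
  ... | inj₁ refl | inj₂ refl with vertex-outside q (a ∷ b ∷ []) 3≤q
  ...   | v , v∈ , v∉ with cl v v∈
  ...     | inj₁ eq        = v∉ (here eq)
  ...     | inj₂ (inj₁ eq) = v∉ (there (here eq))
  ...     | inj₂ (inj₂ c)  = nothing-between sq v v∈ c

  -- If q lies behind the side from a to b of p, then p lies behind the side of
  -- q that joins the last vertex of q before b to the first vertex after a.
  nonOverlap-sym : {p q : Subset N} → 2 ≤ ∣ q ∣ → NonOverlap p q → NonOverlap q p
  nonOverlap-sym {p} {q} 2≤q (a , b , s , cl)
    with vertex-outside q [] (ℕₚ.≤-trans (s≤s z≤n) 2≤q)
  ... | x₀ , x₀∈ , _ with minimiser (dist a) (lookup q) x₀∈ | maximiser (dist a) (lookup q) x₀∈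
  ... | y , y∈ , least | x , x∈ , most = x , y , side x≢y x∈ y∈ gap , behind
    where
    between : ∀ z → z ∈ᵖ q → z ≢ x → z ≢ y → dist a y < dist a z × dist a z < dist a x
    between z z∈ z≢x z≢y = ℕₚ.≤∧≢⇒< (least z z∈) (z≢y ∘ sym ∘ dist-injective)
                         , ℕₚ.≤∧≢⇒< (most z z∈) (z≢x ∘ dist-injective)
    x≢y : x ≢ y
    x≢y refl with vertex-outside q (x ∷ []) 2≤q
    ... | z , z∈ , z∉ with between z z∈ (z∉ ∘ here) (z∉ ∘ here)
    ...   | lt , gt = ℕₚ.<-asym lt gt
    y<x : dist a y < dist a x
    y<x = ℕₚ.≤∧≢⇒< (least x x∈) (x≢y ∘ sym ∘ dist-injective)
    gap : ∀ z → z ∈ᵖ q → ¬ Cyc x z y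
    gap z z∈ c with between z z∈ (proj₁ (cyc-distinct c) ∘ sym) (proj₁ (proj₂ (cyc-distinct c)))
    ... | lt , gt = cyc-asym (cyc-rotate (cyc-rotate c)) (dist⇒cyc₃ lt gt)
    x≤b : dist a x ≤ dist a b
    x≤b with cl x x∈
    ... | inj₁ refl        = subst (_≤ dist a b) (sym (dist-self a)) z≤n
    ... | inj₂ (inj₁ refl) = ℕₚ.≤-refl
    ... | inj₂ (inj₂ c)    = ℕₚ.<⇒≤ (cyc⇒dist c)
    behind : ∀ z → z ∈ᵖ p → ClosedArc x y z
    behind z z∈ with z Fin.≟ x | z Fin.≟ y
    ... | yes eq | _      = inj₁ eq
    ... | no _   | yes eq = inj₂ (inj₁ eq)
    ... | no z≢x | no z≢y with cyc-total (z≢x ∘ sym) z≢y x≢y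
    ...   | inj₁ c = inj₂ (inj₂ c)
    ...   | inj₂ c with cyc⇒dist₃ y<x (cyc-rotate c)
    ...     | lt , gt = contradiction (dist⇒cyc a≢z (ℕₚ.<-≤-trans gt x≤b)) (nothing-between s z z∈)
      where
      a≢z : a ≢ z
      a≢z refl = ℕₚ.n≮0 (subst (dist a y <_) (dist-self a) lt)

  -- Seen from its vertex v, the polygon p contains the direction just before z.
  record Sector (z v : Fin N) (p : Subset N) : Set where
    constructor sector
    field
      vertex∈ : v ∈ᵖ p
      before  : ∃ λ w → w ∈ᵖ p × Cyc v w z
      after   : ∃ λ u → u ∈ᵖ p × u ≢ v × (u ≡ z ⊎ Cyc v z u)

  -- If `q` lies behind the side from `a` to `b` of `p`, the common vertex `v` is an end of it.
  -- Counterclockwise from `v`, both `w` and `w′` come before `z`, while `u` and `u′` do not. For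
  -- `v` equal to `a`, this puts `w` before `u′` and so strictly inside the side; for `v` equal to
  -- `b`, it puts `u` after `w′` and so strictly inside.
  sector-unique : {z v : Fin N} {p q : Subset N} → Sector z v p → Sector z v q → ¬ NonOverlap p q
  sector-unique {z} {v} (sector v∈ (w , w∈ , wz) (u , u∈ , u≢v , zu)) (sector v∈′ (w′ , w′∈ , w′z) (u′ , u′∈ , u′≢v , zu′))
    (a , b , s , cl) with endpoint s v∈ (cl v v∈′)
  ... | inj₁ refl = nothing-between s w w∈ (dist⇒cyc (proj₁ (cyc-distinct wz)) w<b)
    where
    z≤u′ : dist v z ≤ dist v u′
    z≤u′ = [ (λ { refl → ℕₚ.≤-refl }) , (λ c → ℕₚ.<⇒≤ (cyc⇒dist c)) ]′ zu′
    u′≤b : dist v u′ ≤ dist v b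
    u′≤b with cl u′ u′∈
    ... | inj₁ eq          = contradiction eq u′≢v
    ... | inj₂ (inj₁ refl) = ℕₚ.≤-refl
    ... | inj₂ (inj₂ c)    = ℕₚ.<⇒≤ (cyc⇒dist c)
    w<b : dist v w < dist v b
    w<b = ℕₚ.<-≤-trans (cyc⇒dist wz) (ℕₚ.≤-trans z≤u′ u′≤b)
  ... | inj₂ refl = nothing-between s u u∈ (cyc-rotate (dist⇒cyc (distinct-ends s ∘ sym) a<u))
    where
    z≤u : dist v z ≤ dist v u
    z≤u = [ (λ { refl → ℕₚ.≤-refl }) , (λ c → ℕₚ.<⇒≤ (cyc⇒dist c)) ]′ zu
    a≤w′ : dist v a ≤ dist v w′
    a≤w′ with cl w′ w′∈
    ... | inj₁ refl      = ℕₚ.≤-refl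
    ... | inj₂ (inj₁ eq) = contradiction (sym eq) (proj₁ (cyc-distinct w′z))
    ... | inj₂ (inj₂ c)  = ℕₚ.<⇒≤ (cyc⇒dist (cyc-rotate (cyc-rotate c)))
    a<u : dist v a < dist v u
    a<u = ℕₚ.≤-<-trans a≤w′ (ℕₚ.<-≤-trans (cyc⇒dist w′z) z≤u)

  -- Only the first vertex `f` and the last vertex `l` of `p`, counted from `z`, are dropped. For
  -- every other vertex `v`, they serve as the witnesses after and before the direction of `z`.
  sectors : (z : Fin N) (p : Subset N) → 1 ≤ ∣ p ∣ →
    ∃ λ vs → Unique vs × All (λ v → Sector z v p) vs × ∣ p ∣ ≤ 2 ℕ.+ length vs
  sectors z p 1≤p with vertex-outside p [] 1≤p
  ... | x₀ , x₀∈ , _ with minimiser (dist z) (lookup p) x₀∈ | maximiser (dist z) (lookup p) x₀∈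
  ... | f , f∈ , least | l , l∈ , most = List.filter inner? (members p)
      , Uniqueₚ.filter⁺ inner? (unique-members p)
      , All.tabulate (λ v∈ → is-sector (∈ₚ.∈-filter⁻ inner? {xs = members p} v∈))
      , subst (_≤ 2 ℕ.+ length (List.filter inner? (members p))) (length-members p)
          (length-⊆ {ys = f ∷ l ∷ List.filter inner? (members p)} (unique-members p) cover)
    where
    inner? : (v : Fin N) → Dec (v ≢ f × v ≢ l)
    inner? v = ¬? (v Fin.≟ f) ×-dec ¬? (v Fin.≟ l)
    cover : members p ⊆ f ∷ l ∷ List.filter inner? (members p)
    cover {v} v∈ with v Fin.≟ f | v Fin.≟ l
    ... | yes eq | _      = here eq
    ... | no _   | yes eq = there (here eq)
    ... | no v≢f | no v≢l = there (there (∈ₚ.∈-filter⁺ inner? v∈ (v≢f , v≢l)))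
    is-sector : {v : Fin N} → v ∈ members p × (v ≢ f × v ≢ l) → Sector z v p
    is-sector {v} (v∈ , v≢f , v≢l) = sector (∈-members⁻ {p = p} v∈)
      (l , l∈ , cyc-rotate (dist⇒cyc z≢v (ℕₚ.≤∧≢⇒< (most v (∈-members⁻ {p = p} v∈)) (v≢l ∘ dist-injective))))
      (f , f∈ , v≢f ∘ sym , z≤f)
      where
      f<v : dist z f < dist z v
      f<v = ℕₚ.≤∧≢⇒< (least v (∈-members⁻ {p = p} v∈)) (v≢f ∘ sym ∘ dist-injective)
      z≢v : z ≢ v
      z≢v refl = ℕₚ.n≮0 (subst (dist z f <_) (dist-self z) f<v)
      z≤f : f ≡ z ⊎ Cyc v z f
      z≤f with z Fin.≟ f
      ... | yes eq = inj₁ (sym eq)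
      ... | no z≢f = inj₂ (cyc-rotate (cyc-rotate (dist⇒cyc z≢f f<v)))

  module _ {n : ℕ} (p : Fin n → Subset N) (k : ℕ) (sizes : ∀ i → ∣ p i ∣ ≡ 2 ℕ.+ k)
           (apart : ∀ i j → i ≢ j → NonOverlap (p i) (p j)) where

    -- The sector vertices of different polygons are disjoint by `sector-unique`, so the lower
    -- bounds for the single polygons add up.
    all-sectors : (z : Fin N) (is : List (Fin n)) → Unique is →
      ∃ λ vs → Unique vs × All (λ v → ∃ λ i → i ∈ is × Sector z v (p i)) vs × length is ℕ.* k ≤ length vs
    all-sectors z [] _ = [] , [] , [] , z≤n
    all-sectors z (i ∷ is) u@(_ ∷ uis)
      with all-sectors z is uis | sectors z (p i) (subst (1 ≤_) (sym (sizes i)) (s≤s z≤n))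
    ... | vs , uvs , secs , long | ws , uws , secs′ , long′ = ws ++ vs , Uniqueₚ.++⁺ uws uvs disjoint
        , Allₚ.++⁺ (All.map (λ s → i , here refl , s) secs′) (All.map (λ { (j , j∈ , s) → j , there j∈ , s }) secs)
        , subst (k ℕ.+ length is ℕ.* k ≤_) (sym (Listₚ.length-++ ws))
            (ℕₚ.+-mono-≤ (ℕₚ.+-cancelˡ-≤ 2 _ _ (subst (_≤ 2 ℕ.+ length ws) (sizes i) long′)) long)
      where
      disjoint : ∀ {v} → ¬ (v ∈ ws × v ∈ vs)
      disjoint (v∈ws , v∈vs) with All.lookup secs v∈vs
      ... | j , j∈ , s = sector-unique (All.lookup secs′ v∈ws) s
              (apart i j λ { refl → Uniqueₚ.Unique[x∷xs]⇒x∉xs u j∈ })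

-- Indicators, signs and the number of sides

indicator-true : {b : Bool} → T b → indicator b ≡ 1ℤ
indicator-true {true} _ = refl

indicator-false : {b : Bool} → ¬ T b → indicator b ≡ 0ℤ
indicator-false {true}  ¬t = contradiction tt ¬t
indicator-false {false} _  = refl

sign : Bool → ℤ
sign true  = 1ℤ
sign false = -1ℤ

side? : {N : ℕ} (p : Subset N) (a b : Fin N) → Dec (Side p a b)
side? p a b = map′ side⁻ side⁺ (T? (consecutive p a b))

next-end : {M : ℕ} {p : Subset (suc (suc M))} {a : Fin (suc (suc M))} →
  a ∈ᵖ p → next a ∈ᵖ p → Side p a (next a)
next-end {a = a} a∈ b∈ = side (next≢ a) a∈ b∈ λ x _ → next-adjacent

not-backwards : {M : ℕ} {p : Subset (suc M)} {a : Fin (suc M)} → 3 ≤ ∣ p ∣ → ¬ Side p (next a) a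
not-backwards 3≤p s = open-ended 3≤p s (side (distinct-ends s ∘ sym) (end∈ s) (start∈ s) λ x _ → next-adjacent)

-- Each vertex of a polygon is the start of exactly one directed side.
∑-sides-from : {N : ℕ} (p : Subset N) → 2 ≤ ∣ p ∣ → ∀ a →
  ∑ (allFin N) (λ b → indicator (consecutive p a b)) ≡ indicator (lookup p a)
∑-sides-from {N} p 2≤p a with T? (a ∈ᵇ p)
... | no a∉  = trans (∑-zero (allFin N) λ b → indicator-false (a∉ ∘ start∈ ∘ side⁻ {p = p} {a} {b}))
                     (sym (indicator-false a∉))
... | yes a∈ with side-exists {p = p} 2≤p a∈
...   | b , s = trans (∑-single (Uniqueₚ.allFin⁺ N) (∈ₚ.∈-allFin b)
                        λ b′ b′≢b → indicator-false λ t → b′≢b (side-end-unique (side⁻ t) s))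
                      (trans (indicator-true (side⁺ s)) (sym (indicator-true a∈)))

∑-sides : {N : ℕ} (p : Subset N) → 2 ≤ ∣ p ∣ →
  ∑ (allFin N) (λ a → ∑ (allFin N) (λ b → indicator (consecutive p a b))) ≡ + ∣ p ∣
∑-sides {N} p 2≤p = trans (∑-cong (allFin N) (∑-sides-from p 2≤p)) (sym (∣∣-∑ p))

-- Covering of all edges and the signed flow along them

module _ {m n : ℕ} (p : Fin n → Subset (3 ℕ.+ m)) (k : ℕ) (1≤k : 1 ≤ k) (sizes : ∀ i → ∣ p i ∣ ≡ 2 ℕ.+ k)
         (apart : ∀ i j → i ≢ j → NonOverlap (p i) (p j)) (full : 3 ℕ.+ m ≡ 2 ℕ.+ n ℕ.* k) where

  private
    N : ℕ
    N = 3 ℕ.+ m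

    3≤size : ∀ i → 3 ≤ ∣ p i ∣
    3≤size i = subst (3 ≤_) (sym (sizes i)) (s≤s (s≤s 1≤k))

    2≤size : ∀ i → 2 ≤ ∣ p i ∣
    2≤size i = ℕₚ.≤-trans (s≤s (s≤s z≤n)) (3≤size i)

  sector-covered : ∀ z v → v ≢ z → next v ≢ z → ∃ λ i → Sector z v (p i)
  sector-covered z v v≢z nv≢z with all-sectors p k sizes apart z (allFin n) (Uniqueₚ.allFin⁺ n)
  ... | vs , uvs , secs , long = find (length-⊆-full Fin._≟_ unique (λ _ → ∈ₚ.∈-allFin _) bound (∈ₚ.∈-allFin v))
    where
    -- The witness `w` lies strictly between `v` and `z`, which leaves no room if `v` is `z` or
    -- `prev z`. Adding these two to the sector vertices gives at least N distinct vertices.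
    avoids : ∀ {v} → v ∈ vs → v ≢ z × next v ≢ z
    avoids v∈ with All.lookup secs v∈
    ... | _ , _ , sector _ (w , _ , c) _ = proj₂ (proj₂ (cyc-distinct c)) , λ { refl → next-adjacent c }
    unique : Unique (z ∷ prev z ∷ vs)
    unique = ((λ eq → next≢ z (sym (trans (cong next eq) (next-prev z)))) ∷ All.tabulate λ v∈ eq → proj₁ (avoids v∈) (sym eq))
           ∷ All.tabulate (λ { v∈ refl → proj₂ (avoids v∈) (next-prev z) })
           ∷ uvs
    bound : length (allFin N) ≤ length (z ∷ prev z ∷ vs)
    bound = begin
      length (allFin N)                ≡⟨ Listₚ.length-tabulate {n = N} id ⟩
      N                                ≡⟨ full ⟩
      2 ℕ.+ n ℕ.* k                    ≡⟨ cong (λ l → 2 ℕ.+ l ℕ.* k) (Listₚ.length-tabulate {n = n} id) ⟨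
      2 ℕ.+ length (allFin n) ℕ.* k    ≤⟨ s≤s (s≤s long) ⟩
      2 ℕ.+ length vs                  ∎
      where open ℕₚ.≤-Reasoning
    find : v ∈ z ∷ prev z ∷ vs → ∃ λ i → Sector z v (p i)
    find (here eq)                = contradiction eq v≢z
    find (there (here refl))      = contradiction (next-prev z) nv≢z
    find (there (there v∈)) with All.lookup secs v∈
    ... | i , _ , s = i , s

  -- With `z` two steps beyond `a`, the only vertex strictly between `a` and `z` is `next a`, so the
  -- sector witness `w` must be `next a`.
  edge-covered : ∀ a → ∃ λ i → Side (p i) a (next a)
  edge-covered a with sector-covered (next (next a)) a (next²≢ a) (next≢ (next a))
  ... | i , sector a∈ (w , w∈ , c) _ with w Fin.≟ next a
  ...   | yes refl = i , next-end a∈ w∈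
  ...   | no w≢    with cyc-total (proj₁ (cyc-distinct c)) w≢ (next≢ a)
  ...     | inj₁ d = contradiction d next-adjacent
  ...     | inj₂ d = contradiction (dist⇒cyc₃ (cyc⇒dist d) (cyc⇒dist c)) next-adjacent

  -- The sector at `a` just before `b` belongs to some `p j` with a vertex `w` where `p i` has none,
  -- so `j` differs from `i`. The side of `p i` with `p j` behind it has `a` as an end. It cannot
  -- end there because of `w`, so it is the side from `a` to `b`. Then `u`, which is `b` or lies
  -- beyond it, has to be `b`.
  reverse-covered : ∀ {i a b} → b ≢ next a → Side (p i) a b → ∃ λ j → Side (p j) b a
  reverse-covered {i} {a} {b} b≢ s with sector-covered b a (distinct-ends s) (b≢ ∘ sym)
  ... | j , sector a∈ (w , w∈ , c) (u , u∈ , u≢a , after)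
    with apart i j (λ { refl → nothing-between s w w∈ c })
  ... | x , y , t , cl with endpoint t (start∈ s) (cl a a∈)
  ... | inj₂ refl with cl w w∈
  ...   | inj₁ refl        = contradiction c (nothing-between s w (start∈ t))
  ...   | inj₂ (inj₁ refl) = contradiction refl (proj₁ (cyc-distinct c))
  ...   | inj₂ (inj₂ d)    = contradiction (cyc-trans (cyc-rotate (cyc-rotate d)) c) (nothing-between s x (start∈ t))
  reverse-covered {i} {a} {b} b≢ s | j , sector a∈ (w , w∈ , c) (u , u∈ , u≢a , after) | x , y , t , cl | inj₁ refl
    with side-end-unique s t
  ... | refl = j , side (distinct-ends s ∘ sym) b∈ a∈ gap
    where
    b∈-from : ClosedArc a b u → u ≡ b ⊎ Cyc a b u → b ∈ᵖ p j
    b∈-from (inj₁ eq)          _         = contradiction eq u≢a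
    b∈-from (inj₂ (inj₁ refl)) _         = u∈
    b∈-from (inj₂ (inj₂ d))    (inj₁ refl) = u∈
    b∈-from (inj₂ (inj₂ d))    (inj₂ e)    = contradiction e (cyc-asym d)
    b∈ : b ∈ᵖ p j
    b∈ = b∈-from (cl u u∈) after
    gap : ∀ z → z ∈ᵖ p j → ¬ Cyc b z a
    gap z z∈ d with cl z z∈
    ... | inj₁ eq        = proj₁ (proj₂ (cyc-distinct d)) eq
    ... | inj₂ (inj₁ eq) = proj₁ (cyc-distinct d) (sym eq)
    ... | inj₂ (inj₂ e)  = cyc-asym (cyc-rotate d) (cyc-rotate e)

  same-side : ∀ {i j a b} → Side (p i) a b → Side (p j) a b → i ≡ j
  same-side {i} {j} s t with i Fin.≟ j
  ... | yes eq = eq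
  ... | no i≢j = contradiction t (side-not-shared (3≤size i) (3≤size j) (apart i j i≢j) s)

  module _ (c : Fin n → Bool) (proper : ∀ i j → i ≢ j → ShareEdge (p i) (p j) → c i ≢ c j) where

    -- At most one summand is non-zero, by `same-side`: the flow is the sign of the polygon to the
    -- left of the directed edge, or 0 if there is none.
    flow : Fin (3 ℕ.+ m) → Fin (3 ℕ.+ m) → ℤ
    flow a b = ∑ (allFin n) (λ i → sign (c i) *ℤ indicator (consecutive (p i) a b))

    flow-side : ∀ {i a b} → Side (p i) a b → flow a b ≡ sign (c i)
    flow-side {i} {a} {b} s = trans
      (∑-single (Uniqueₚ.allFin⁺ n) (∈ₚ.∈-allFin i) λ j j≢i →
        trans (cong (sign (c j) *ℤ_) (indicator-false λ t → j≢i (same-side (side⁻ t) s))) (ℤₚ.*-zeroʳ (sign (c j))))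
      (trans (cong (sign (c i) *ℤ_) (indicator-true (side⁺ s))) (ℤₚ.*-identityʳ (sign (c i))))

    flow-none : ∀ {a b} → (∀ i → ¬ Side (p i) a b) → flow a b ≡ 0ℤ
    flow-none {a} {b} none = ∑-zero (allFin n) λ i →
      trans (cong (sign (c i) *ℤ_) (indicator-false (none i ∘ side⁻))) (ℤₚ.*-zeroʳ (sign (c i)))

    flow-backwards : ∀ a → flow (next a) a ≡ 0ℤ
    flow-backwards a = flow-none {next a} {a} λ i → not-backwards {p = p i} {a} (3≤size i)

    private
      opposite-signs : ∀ {b b′} → b ≢ b′ → sign b +ℤ sign b′ ≡ 0ℤ
      opposite-signs {true}  {true}  ne = contradiction refl ne
      opposite-signs {true}  {false} ne = refl
      opposite-signs {false} {true}  ne = refl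
      opposite-signs {false} {false} ne = contradiction refl ne

    -- A diagonal that is a side of one polygon is, reversed, a side of another, and these two have
    -- opposite colours. If no polygon has the side from `a` to `b`, then by the same argument none
    -- has the reverse.
    flow-cancels : ∀ a b → b ≢ next a → a ≢ next b → flow a b +ℤ flow b a ≡ 0ℤ
    flow-cancels a b b≢ a≢ with Finₚ.any? (λ i → side? (p i) a b)
    ... | yes (i , s) with reverse-covered b≢ s
    ...   | j , t = trans (cong₂ _+ℤ_ (flow-side s) (flow-side t))
                      (opposite-signs (proper i j i≢j (a , b , inj₁ s , inj₂ t)))
      where
      i≢j : i ≢ j
      i≢j refl = open-ended (3≤size i) s t
    flow-cancels a b b≢ a≢ | no none = cong₂ _+ℤ_ (flow-none λ i s → none (i , s))
      (flow-none λ i s → none (reverse-covered a≢ s))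

    private
      boundary : Fin (3 ℕ.+ m) → Fin (3 ℕ.+ m) → ℤ
      boundary a b = indicator (does (b Fin.≟ next a)) *ℤ flow a b

      boundary-yes : ∀ {a b} → b ≡ next a → boundary a b ≡ flow a b
      boundary-yes {a} {b} eq with b Fin.≟ next a
      ... | yes _ = ℤₚ.*-identityˡ (flow a b)
      ... | no ne = contradiction eq ne

      boundary-no : ∀ {a b} → b ≢ next a → boundary a b ≡ 0ℤ
      boundary-no {a} {b} ne with b Fin.≟ next a
      ... | yes eq = contradiction eq ne
      ... | no _   = ℤₚ.*-zeroˡ (flow a b)

      -- Diagonals contribute 0 to both sides. Along a boundary edge only the counterclockwise
      -- orientation can be a side, and there `boundary` agrees with `flow`.
      symmetrised : ∀ a b → flow a b +ℤ flow b a ≡ boundary a b +ℤ boundary b a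
      symmetrised a b = by-cases a b (b Fin.≟ next a) (a Fin.≟ next b)
        where
        by-cases : ∀ a b → Dec (b ≡ next a) → Dec (a ≡ next b) →
          flow a b +ℤ flow b a ≡ boundary a b +ℤ boundary b a
        by-cases a b (yes refl) _ = cong₂ _+ℤ_ (sym (boundary-yes {a} refl))
          (trans (flow-backwards a) (sym (boundary-no {next a} (next²≢ a))))
        by-cases a b (no _) (yes refl) = cong₂ _+ℤ_
          (trans (flow-backwards b) (sym (boundary-no {next b} (next²≢ b)))) (sym (boundary-yes {b} refl))
        by-cases a b (no b≢) (no a≢) = trans (flow-cancels a b b≢ a≢)
          (sym (cong₂ _+ℤ_ (boundary-no b≢) (boundary-no a≢)))

      ∑∑ : (Fin (3 ℕ.+ m) → Fin (3 ℕ.+ m) → ℤ) → ℤ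
      ∑∑ f = ∑ (allFin N) (λ a → ∑ (allFin N) (f a))

      ∑∑-symmetrise : (f : Fin (3 ℕ.+ m) → Fin (3 ℕ.+ m) → ℤ) →
        ∑∑ (λ a b → f a b +ℤ f b a) ≡ + 2 *ℤ ∑∑ f
      ∑∑-symmetrise f = begin
        ∑∑ (λ a b → f a b +ℤ f b a)
          ≡⟨ ∑-cong (allFin N) (λ a → ∑-+ (allFin N) (f a) (λ b → f b a)) ⟩
        ∑ (allFin N) (λ a → ∑ (allFin N) (f a) +ℤ ∑ (allFin N) (λ b → f b a))
          ≡⟨ ∑-+ (allFin N) (λ a → ∑ (allFin N) (f a)) (λ a → ∑ (allFin N) (λ b → f b a)) ⟩
        ∑∑ f +ℤ ∑∑ (λ a b → f b a)
          ≡⟨ cong (∑∑ f +ℤ_) (∑-swap (allFin N) (allFin N) (λ a b → f b a)) ⟩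
        ∑∑ f +ℤ ∑∑ f
          ≡⟨ double (∑∑ f) ⟩
        + 2 *ℤ ∑∑ f ∎
        where
        open ≡-Reasoning
        double : ∀ x → x +ℤ x ≡ + 2 *ℤ x
        double = solve-∀

      -- Summed polygon by polygon instead of edge by edge, each colour sign is counted once per
      -- side, and every polygon has k + 2 sides.
      ∑∑-flow : ∑∑ flow ≡ + (2 ℕ.+ k) *ℤ ∑ (allFin n) (sign ∘ c)
      ∑∑-flow = begin
        ∑∑ flow
          ≡⟨ ∑-cong (allFin N) (λ a → ∑-swap (allFin N) (allFin n) (λ b i → sign (c i) *ℤ ind i a b)) ⟩
        ∑ (allFin N) (λ a → ∑ (allFin n) (λ i → ∑ (allFin N) (λ b → sign (c i) *ℤ ind i a b)))
          ≡⟨ ∑-swap (allFin N) (allFin n) (λ a i → ∑ (allFin N) (λ b → sign (c i) *ℤ ind i a b)) ⟩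
        ∑ (allFin n) (λ i → ∑ (allFin N) (λ a → ∑ (allFin N) (λ b → sign (c i) *ℤ ind i a b)))
          ≡⟨ ∑-cong (allFin n) polygon ⟩
        ∑ (allFin n) (λ i → + (2 ℕ.+ k) *ℤ sign (c i))
          ≡⟨ ∑-*ˡ (allFin n) (+ (2 ℕ.+ k)) (sign ∘ c) ⟩
        + (2 ℕ.+ k) *ℤ ∑ (allFin n) (sign ∘ c) ∎
        where
        open ≡-Reasoning
        ind : Fin n → Fin N → Fin N → ℤ
        ind i a b = indicator (consecutive (p i) a b)
        polygon : ∀ i → ∑∑ (λ a b → sign (c i) *ℤ ind i a b) ≡ + (2 ℕ.+ k) *ℤ sign (c i)
        polygon i = begin
          ∑∑ (λ a b → sign (c i) *ℤ ind i a b)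
            ≡⟨ ∑-cong (allFin N) (λ a → ∑-*ˡ (allFin N) (sign (c i)) (ind i a)) ⟩
          ∑ (allFin N) (λ a → sign (c i) *ℤ ∑ (allFin N) (ind i a))
            ≡⟨ ∑-*ˡ (allFin N) (sign (c i)) (λ a → ∑ (allFin N) (ind i a)) ⟩
          sign (c i) *ℤ ∑∑ (ind i)
            ≡⟨ cong (sign (c i) *ℤ_) (trans (∑-sides (p i) (2≤size i)) (cong +_ (sizes i))) ⟩
          sign (c i) *ℤ + (2 ℕ.+ k)
            ≡⟨ ℤₚ.*-comm (sign (c i)) (+ (2 ℕ.+ k)) ⟩
          + (2 ℕ.+ k) *ℤ sign (c i) ∎

    -- `flow` and `boundary` agree only after adding both orientations, so the double sums are first
    -- compared with a factor 2, which is then cancelled.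
    ∑-boundary-flow : ∑ (allFin (3 ℕ.+ m)) (λ a → flow a (next a)) ≡ + (2 ℕ.+ k) *ℤ ∑ (allFin n) (sign ∘ c)
    ∑-boundary-flow = begin
      ∑ (allFin N) (λ a → flow a (next a))
        ≡⟨ ∑-cong (allFin N) (λ a → sym (trans
             (∑-single (Uniqueₚ.allFin⁺ N) (∈ₚ.∈-allFin (next a)) λ b → boundary-no)
             (boundary-yes {a} refl))) ⟩
      ∑∑ boundary
        ≡⟨ ℤₚ.*-cancelˡ-≡ (+ 2) _ _ (trans (sym (∑∑-symmetrise boundary))
             (trans (∑-cong (allFin N) λ a → ∑-cong (allFin N) λ b → sym (symmetrised a b)) (∑∑-symmetrise flow))) ⟩
      ∑∑ flow
        ≡⟨ ∑∑-flow ⟩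
      + (2 ℕ.+ k) *ℤ ∑ (allFin n) (sign ∘ c) ∎
      where open ≡-Reasoning

-- Insertion sort of vectors

insert : (A → A → Bool) → A → Vec A l → Vec A (suc l)
insert _<?_ x [] = x ∷ []
insert _<?_ x (y ∷ ys) with x <? y
... | true  = x ∷ y ∷ ys
... | false = y ∷ insert _<?_ x ys

sort : (A → A → Bool) → Vec A l → Vec A l
sort _<?_ []       = []
sort _<?_ (x ∷ xs) = insert _<?_ x (sort _<?_ xs)

module _ (_<?_ : A → A → Bool) where

  All-insert : {P : A → Set} {x : A} {xs : Vec A l} → P x → AllV P xs → AllV P (insert _<?_ x xs)
  All-insert px [] = px ∷ []
  All-insert {x = x} {y ∷ _} px (py ∷ pys) with x <? y
  ... | true  = px ∷ py ∷ pys
  ... | false = py ∷ All-insert px pys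

  All-sort : {P : A → Set} {xs : Vec A l} → AllV P xs → AllV P (sort _<?_ xs)
  All-sort []         = []
  All-sort (px ∷ pxs) = All-insert px (All-sort pxs)

  ∈-insert⁺ : {x : A} (xs : Vec A l) {z : A} → z ∈ⱽ x ∷ xs → z ∈ⱽ insert _<?_ x xs
  ∈-insert⁺ [] z∈ = z∈
  ∈-insert⁺ {x = x} (y ∷ ys) z∈ with x <? y
  ∈-insert⁺ (y ∷ ys) z∈                 | true  = z∈
  ∈-insert⁺ (y ∷ ys) (here refl)        | false = there (∈-insert⁺ ys (here refl))
  ∈-insert⁺ (y ∷ ys) (there (here eq))  | false = here eq
  ∈-insert⁺ (y ∷ ys) (there (there z∈)) | false = there (∈-insert⁺ ys (there z∈))

  ∈-sort⁺ : {xs : Vec A l} {z : A} → z ∈ⱽ xs → z ∈ⱽ sort _<?_ xs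
  ∈-sort⁺ {xs = x ∷ xs} (here eq)  = ∈-insert⁺ (sort _<?_ xs) (here eq)
  ∈-sort⁺ {xs = x ∷ xs} (there z∈) = ∈-insert⁺ (sort _<?_ xs) (there (∈-sort⁺ z∈))

  ∈-sort⁻ : {xs : Vec A l} {z : A} → z ∈ⱽ sort _<?_ xs → z ∈ⱽ xs
  ∈-sort⁻ z∈ = VAll.lookup (All-sort (all-∈ _)) z∈
    where
    all-∈ : ∀ {l} (xs : Vec A l) → AllV (_∈ⱽ xs) xs
    all-∈ xs = VAllₚ.lookup⁻ λ i → ∈Vecₚ.∈-lookup i xs

  module _ (S : A → A → Set) (S-sym : ∀ {x y} → S x y → S y x)
           (<-trans : ∀ {x y z} → T (x <? y) → T (y <? z) → T (x <? z))
           (<-total : ∀ {x y} → S x y → ¬ T (x <? y) → T (y <? x)) where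

    -- The order is total only on pairs related by `S`, so `S` has to be carried through the
    -- sorting. Its symmetry allows for the change of positions.
    AllPairs-insert : {x : A} {xs : Vec A l} → AllV (S x) xs →
      AllPairsV (λ y z → T (y <? z) × S y z) xs → AllPairsV (λ y z → T (y <? z) × S y z) (insert _<?_ x xs)
    AllPairs-insert [] [] = [] ∷ []
    AllPairs-insert {x = x} {y ∷ ys} (sxy ∷ sx) (sy ∷ srt) with x <? y in eq
    ... | true  = ((x<y , sxy) ∷ VAll.map (λ { (s , y<z , _) → <-trans x<y y<z , s }) (VAll.zip (sx , sy))) ∷ sy ∷ srt
      where
      x<y : T (x <? y)
      x<y = subst T (sym eq) tt
    ... | false = All-insert (<-total sxy (subst T eq) , S-sym sxy) sy ∷ AllPairs-insert sx srt

    AllPairs-sort : {xs : Vec A l} → AllPairsV S xs → AllPairsV (λ y z → T (y <? z) × S y z) (sort _<?_ xs)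
    AllPairs-sort []         = []
    AllPairs-sort (sx ∷ sxs) = AllPairs-insert (All-sort sx) (AllPairs-sort sxs)

-- If the heads differed, each would occur in the tail of the other vector, giving `R` in both
-- directions. Asymmetry also excludes repetitions, so that membership passes to the tails.
sorted-unique : {R : A → A → Set} → (∀ {x y} → R x y → ¬ R y x) → {xs ys : Vec A l} →
  AllPairsV R xs → AllPairsV R ys →
  (∀ {z} → z ∈ⱽ xs → z ∈ⱽ ys) → (∀ {z} → z ∈ⱽ ys → z ∈ⱽ xs) → xs ≡ ys
sorted-unique asym [] [] _ _ = refl
sorted-unique {A = A} {R = R} asym {x ∷ xs} {y ∷ ys} (rx ∷ rxs) (ry ∷ rys) to from with heads (to (here refl)) (from (here refl))
  where
  heads : x ∈ⱽ y ∷ ys → y ∈ⱽ x ∷ xs → x ≡ y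
  heads (here eq)  _           = eq
  heads (there _)  (here eq)   = sym eq
  heads (there x∈) (there y∈)  = contradiction (VAll.lookup ry x∈) (asym (VAll.lookup rx y∈))
... | refl = cong (x ∷_) (sorted-unique asym rxs rys
    (λ z∈ → drop (VAll.lookup rx z∈) (to (there z∈))) (λ z∈ → drop (VAll.lookup ry z∈) (from (there z∈))))
  where
  drop : ∀ {m} {zs : Vec A m} {z} → R x z → z ∈ⱽ x ∷ zs → z ∈ⱽ zs
  drop r (here refl) = contradiction r (asym r)
  drop r (there z∈)  = z∈

AllPairs⁺ : {R : A → A → Set} (xs : Vec A l) →
  (∀ i j → toℕ i < toℕ j → R (lookup xs i) (lookup xs j)) → AllPairsV R xs
AllPairs⁺ []       r = []
AllPairs⁺ (x ∷ xs) r = VAllₚ.lookup⁻ (λ i → r zero (suc i) (s≤s z≤n)) ∷ AllPairs⁺ xs (λ i j lt → r (suc i) (suc j) (s≤s lt))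

AllPairs⁻ : {R : A → A → Set} {xs : Vec A l} → AllPairsV R xs →
  ∀ i j → toℕ i < toℕ j → R (lookup xs i) (lookup xs j)
AllPairs⁻ (r ∷ _)  zero    (suc j) _        = VAllₚ.lookup⁺ r j
AllPairs⁻ (_ ∷ rs) (suc i) (suc j) (s≤s lt) = AllPairs⁻ rs i j lt

-- The lexicographic order

lexLt-irrefl : (p : Vec Bool l) → ¬ T (lexLt p p)
lexLt-irrefl (true  ∷ p) t = lexLt-irrefl p t
lexLt-irrefl (false ∷ p) t = lexLt-irrefl p t

lexLt-trans : (p q r : Vec Bool l) → T (lexLt p q) → T (lexLt q r) → T (lexLt p r)
lexLt-trans [] [] [] ()
lexLt-trans (true  ∷ p) (true  ∷ q) (true  ∷ r) s t = lexLt-trans p q r s t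
lexLt-trans (false ∷ p) (false ∷ q) (false ∷ r) s t = lexLt-trans p q r s t
lexLt-trans (false ∷ p) (false ∷ q) (true  ∷ r) s t = tt
lexLt-trans (false ∷ p) (true  ∷ q) (true  ∷ r) s t = tt

lexLt-total : (p q : Vec Bool l) → p ≢ q → ¬ T (lexLt p q) → T (lexLt q p)
lexLt-total []          []          ne ¬t = contradiction refl ne
lexLt-total (true  ∷ p) (true  ∷ q) ne ¬t = lexLt-total p q (ne ∘ cong (true ∷_)) ¬t
lexLt-total (true  ∷ p) (false ∷ q) ne ¬t = tt
lexLt-total (false ∷ p) (true  ∷ q) ne ¬t = contradiction tt ¬t
lexLt-total (false ∷ p) (false ∷ q) ne ¬t = lexLt-total p q (ne ∘ cong (false ∷_)) ¬t

-- Rotating polygons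

rotate : {M : ℕ} → Subset (suc M) → Subset (suc M)
rotate (x ∷ p) = p Vec.∷ʳ x

lookup-∷ʳ-inject₁ : (xs : Vec A l) (x : A) (i : Fin l) → lookup (xs Vec.∷ʳ x) (Fin.inject₁ i) ≡ lookup xs i
lookup-∷ʳ-inject₁ (_ ∷ xs) x zero    = refl
lookup-∷ʳ-inject₁ (_ ∷ xs) x (suc i) = lookup-∷ʳ-inject₁ xs x i

lookup-∷ʳ-fromℕ : (xs : Vec A l) (x : A) → lookup (xs Vec.∷ʳ x) (Fin.fromℕ l) ≡ x
lookup-∷ʳ-fromℕ []       x = refl
lookup-∷ʳ-fromℕ (_ ∷ xs) x = lookup-∷ʳ-fromℕ xs x

lookup-rotate : {M : ℕ} (p : Subset (suc M)) (i : Fin (suc M)) → lookup (rotate p) i ≡ lookup p (next i)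
lookup-rotate (x ∷ p) i with view i
... | ‵fromℕ     = lookup-∷ʳ-fromℕ p x
... | ‵inject₁ j = lookup-∷ʳ-inject₁ p x j

∣rotate∣ : {M : ℕ} (p : Subset (suc M)) → ∣ rotate p ∣ ≡ ∣ p ∣
∣rotate∣ (x ∷ p) = snoc x p
  where
  snoc : ∀ {l} (x : Bool) (p : Subset l) → ∣ p Vec.∷ʳ x ∣ ≡ ∣ x ∷ p ∣
  snoc x     []          = refl
  snoc true  (true  ∷ p) = cong suc (snoc true p)
  snoc false (true  ∷ p) = cong suc (snoc false p)
  snoc true  (false ∷ p) = snoc true p
  snoc false (false ∷ p) = snoc false p

module _ {M : ℕ} where

  rotate-injective : {p q : Subset (suc M)} → rotate p ≡ rotate q → p ≡ q
  rotate-injective {x ∷ p} {y ∷ q} eq with Vecₚ.∷ʳ-injective p q eq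
  ... | refl , refl = refl

  ∈-rotate⁺ : {p : Subset (suc M)} {i : Fin (suc M)} → next i ∈ᵖ p → i ∈ᵖ rotate p
  ∈-rotate⁺ {p} {i} = subst T (sym (lookup-rotate p i))

  ∈-rotate⁻ : {p : Subset (suc M)} {i : Fin (suc M)} → i ∈ᵖ rotate p → next i ∈ᵖ p
  ∈-rotate⁻ {p} {i} = subst T (lookup-rotate p i)

  side-rotate⁻ : {p : Subset (suc M)} {a b : Fin (suc M)} → Side (rotate p) a b → Side p (next a) (next b)
  side-rotate⁻ {p} {a} {b} (side a≢b a∈ b∈ e) = side (a≢b ∘ next-injective) (∈-rotate⁻ {p} {a} a∈) (∈-rotate⁻ {p} {b} b∈)
    λ x x∈ c → e (prev x) (∈-rotate⁺ {p} {prev x} (subst (_∈ᵖ p) (sym (next-prev x)) x∈))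
      (cyc-next⁻ (subst (λ y → Cyc (next a) y (next b)) (sym (next-prev x)) c))

  side-rotate⁺ : {p : Subset (suc M)} {a b : Fin (suc M)} → Side p (next a) (next b) → Side (rotate p) a b
  side-rotate⁺ {p} {a} {b} (side a≢b a∈ b∈ e) = side (a≢b ∘ cong next) (∈-rotate⁺ {p} {a} a∈) (∈-rotate⁺ {p} {b} b∈)
    λ x x∈ c → e (next x) (∈-rotate⁻ {p} {x} x∈) (cyc-next c)

  nonOverlap-rotate : {p q : Subset (suc M)} → NonOverlap p q → NonOverlap (rotate p) (rotate q)
  nonOverlap-rotate {p} {q} (a , b , s , cl) = prev a , prev b
    , side-rotate⁺ (subst₂ (Side p) (sym (next-prev a)) (sym (next-prev b)) s)
    , λ x x∈ → back x (cl (next x) (∈-rotate⁻ {q} {x} x∈))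
    where
    back : ∀ x → ClosedArc a b (next x) → ClosedArc (prev a) (prev b) x
    back x (inj₁ eq)        = inj₁ (trans (sym (prev-next x)) (cong prev eq))
    back x (inj₂ (inj₁ eq)) = inj₂ (inj₁ (trans (sym (prev-next x)) (cong prev eq)))
    back x (inj₂ (inj₂ c))  = inj₂ (inj₂ (cyc-next⁻
      (subst₂ (λ a b → Cyc a (next x) b) (sym (next-prev a)) (sym (next-prev b)) c)))

  shareEdge-rotate : {p q : Subset (suc M)} → ShareEdge (rotate p) (rotate q) → ShareEdge p q
  shareEdge-rotate (a , b , s , t) = next a , next b , Sum.map side-rotate⁻ side-rotate⁻ s , Sum.map side-rotate⁻ side-rotate⁻ t

-- Coloured dissections as vectors of coloured polygons

zip-unzip : (zs : Vec (A × B) l) → Vec.zip (Vec.map proj₁ zs) (Vec.map proj₂ zs) ≡ zs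
zip-unzip []       = refl
zip-unzip (z ∷ zs) = cong (z ∷_) (zip-unzip zs)

map-proj₂-zip : (xs : Vec A l) (ys : Vec B l) → Vec.map proj₂ (Vec.zip xs ys) ≡ ys
map-proj₂-zip []       []       = refl
map-proj₂-zip (x ∷ xs) (y ∷ ys) = cong (y ∷_) (map-proj₂-zip xs ys)

zip-injective : {xs xs′ : Vec A l} {ys ys′ : Vec B l} → Vec.zip xs ys ≡ Vec.zip xs′ ys′ → (xs , ys) ≡ (xs′ , ys′)
zip-injective {xs = []}    {[]}    {[]}    {[]}    _  = refl
zip-injective {xs = _ ∷ _} {_ ∷ _} {_ ∷ _} {_ ∷ _} eq with Vecₚ.∷-injective eq
... | refl , eq′ with zip-injective eq′
... | refl = refl

all-pairsLt⁺ : {f : Fin l × Fin l → Bool} → (∀ i j → toℕ i < toℕ j → T (f (i , j))) → T (all f (pairsLt l))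
all-pairsLt⁺ {l} {f} p = Allₚ.all⁻ f (All.tabulate {xs = pairsLt l} λ { {i , j} ij∈ →
  p i j (ℕₚ.<ᵇ⇒< (toℕ i) (toℕ j) (proj₂ (∈-filterᵇ⁻ _ {List.cartesianProduct (allFin l) (allFin l)} ij∈))) })

all-pairsLt⁻ : {f : Fin l × Fin l → Bool} → T (all f (pairsLt l)) → ∀ i j → toℕ i < toℕ j → T (f (i , j))
all-pairsLt⁻ {l} {f} p i j lt = All.lookup (Allₚ.all⁺ f (pairsLt l) p)
  (∈-filterᵇ⁺ _ {xs = List.cartesianProduct (allFin l) (allFin l)}
    (∈ₚ.∈-cartesianProduct⁺ (∈ₚ.∈-allFin i) (∈ₚ.∈-allFin j)) (ℕₚ.<⇒<ᵇ lt))

blackMinusWhite-∷ : (b : Bool) (c : Vec Bool l) → blackMinusWhite (b ∷ c) ≡ sign b +ℤ blackMinusWhite c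
blackMinusWhite-∷ true c = begin
  suc (numBlack c) ⊖ numWhite c            ≡⟨ ℤₚ.m-n≡m⊖n (suc (numBlack c)) (numWhite c) ⟨
  (1ℤ +ℤ + numBlack c) -ℤ + numWhite c     ≡⟨ ℤₚ.+-assoc 1ℤ (+ numBlack c) (-ℤ + numWhite c) ⟩
  1ℤ +ℤ (+ numBlack c -ℤ + numWhite c)     ≡⟨ cong (1ℤ +ℤ_) (ℤₚ.m-n≡m⊖n (numBlack c) (numWhite c)) ⟩
  1ℤ +ℤ (numBlack c ⊖ numWhite c)          ∎
  where open ≡-Reasoning
blackMinusWhite-∷ false c = begin
  numBlack c ⊖ suc (numWhite c)            ≡⟨ ℤₚ.m-n≡m⊖n (numBlack c) (suc (numWhite c)) ⟨
  + numBlack c -ℤ (1ℤ +ℤ + numWhite c)     ≡⟨ lem (+ numBlack c) (+ numWhite c) ⟩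
  -1ℤ +ℤ (+ numBlack c -ℤ + numWhite c)    ≡⟨ cong (-1ℤ +ℤ_) (ℤₚ.m-n≡m⊖n (numBlack c) (numWhite c)) ⟩
  -1ℤ +ℤ (numBlack c ⊖ numWhite c)         ∎
  where
  open ≡-Reasoning
  lem : ∀ x y → x -ℤ (1ℤ +ℤ y) ≡ -1ℤ +ℤ (x -ℤ y)
  lem = solve-∀

blackMinusWhite-∑ : (c : Vec Bool l) → blackMinusWhite c ≡ ∑ (allFin l) (sign ∘ lookup c)
blackMinusWhite-∑ []      = refl
blackMinusWhite-∑ (b ∷ c) = trans (blackMinusWhite-∷ b c)
  (trans (cong (sign b +ℤ_) (blackMinusWhite-∑ c)) (sym (∑-allFin-suc (sign ∘ lookup (b ∷ c)))))

sign-not : ∀ b → sign (not b) ≡ -ℤ sign b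
sign-not true  = refl
sign-not false = refl

-- Coloured families under rotation and exchange of colours

module _ {m : ℕ} (d : ℕ) (2≤d : 2 ≤ d) where

  Piece : Set
  Piece = Subset (3 ℕ.+ m) × Bool

  _≺ᵇ_ : Piece → Piece → Bool
  (p , _) ≺ᵇ (q , _) = lexLt p q

  -- The sizes are included to make the relation symmetric: `nonOverlap-sym` needs two vertices in
  -- the polygon that lies behind a side.
  record Compatible (z w : Piece) : Set where
    constructor compatible
    field
      sizeˡ : ∣ proj₁ z ∣ ≡ suc d
      sizeʳ : ∣ proj₁ w ∣ ≡ suc d
      apart : NonOverlap (proj₁ z) (proj₁ w)
      proper : ShareEdge (proj₁ z) (proj₁ w) → proj₂ z ≢ proj₂ w

  open Compatible public

  compatible-sym : {z w : Piece} → Compatible z w → Compatible w z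
  compatible-sym (compatible s t a pr) = compatible t s
    (nonOverlap-sym (subst (2 ≤_) (sym t) (ℕₚ.m≤n⇒m≤1+n 2≤d)) a) (λ e eq → pr (shareEdge-sym e) (sym eq))

  -- A properly coloured dissection without the marked-edge condition. `sizes` is stated separately
  -- because a single polygon forms no pair.
  record Family (zs : Vec Piece l) : Set where
    constructor family
    field
      sizes : AllV (λ z → ∣ proj₁ z ∣ ≡ suc d) zs
      pairs : AllPairsV (λ z w → T (z ≺ᵇ w) × Compatible z w) zs

  balance : Vec Piece l → ℤ
  balance zs = blackMinusWhite (Vec.map proj₂ zs)

  -- The marked-edge condition for an arbitrary boundary edge and colour. It would hold vacuously
  -- for an edge in no polygon, which `edge-covered` rules out.
  EdgeColour : Fin (3 ℕ.+ m) → Bool → Vec Piece l → Set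
  EdgeColour a col = AllV (λ z → a ∈ᵖ proj₁ z → next a ∈ᵖ proj₁ z → proj₂ z ≡ col)

  rotatePiece : Piece → Piece
  rotatePiece (p , b) = rotate p , b

  rotatePiece-injective : ∀ {z w : Piece} → rotatePiece z ≡ rotatePiece w → z ≡ w
  rotatePiece-injective {z} {w} eq = cong₂ _,_ (rotate-injective {p = proj₁ z} {proj₁ w} (cong proj₁ eq)) (cong proj₂ eq)

  -- Shifting the labels does not respect the lexicographic order, so the canonical listing has to
  -- be restored.
  rotateFamily : Vec Piece l → Vec Piece l
  rotateFamily zs = sort _≺ᵇ_ (Vec.map rotatePiece zs)

  rotate-family : {zs : Vec Piece l} → Family zs → Family (rotateFamily zs)
  rotate-family (family ss ps) = family
    (All-sort _≺ᵇ_ (VAllₚ.map⁺ (VAll.map (λ {z} s → trans (∣rotate∣ (proj₁ z)) s) ss)))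
    (VAllPairs.map (λ { (lt , _ , c) → lt , c })
      (AllPairs-sort _≺ᵇ_ S (λ { (ne , c) → ne ∘ sym , compatible-sym c })
        (λ {x} {y} {z} → lexLt-trans (proj₁ x) (proj₁ y) (proj₁ z))
        (λ { {x} {y} (ne , _) → lexLt-total (proj₁ x) (proj₁ y) ne })
        (VAllPairsₚ.map⁺ (VAllPairs.map rotated ps))))
    where
    -- Distinctness of the polygons is what makes the lexicographic order total. It comes from the
    -- strict order before rotation and survives because `rotate` is injective.
    S : Piece → Piece → Set
    S z w = proj₁ z ≢ proj₁ w × Compatible z w
    rotated : ∀ {z w} → T (z ≺ᵇ w) × Compatible z w → S (rotatePiece z) (rotatePiece w)
    rotated {z} {w} (lt , compatible s t a pr) =
      (λ eq → lexLt-irrefl (proj₁ w) (subst (λ p → T (lexLt p (proj₁ w))) (rotate-injective {p = proj₁ z} {proj₁ w} eq) lt))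
      , compatible (trans (∣rotate∣ (proj₁ z)) s) (trans (∣rotate∣ (proj₁ w)) t)
          (nonOverlap-rotate {p = proj₁ z} {proj₁ w} a) (pr ∘ shareEdge-rotate {p = proj₁ z} {proj₁ w})

  rotate-edgeColour : {a : Fin (3 ℕ.+ m)} {col : Bool} {zs : Vec Piece l} →
    EdgeColour (next a) col zs → EdgeColour a col (rotateFamily zs)
  rotate-edgeColour {a = a} ec = All-sort _≺ᵇ_ (VAllₚ.map⁺ (VAll.map (λ {z} e a∈ b∈ →
    e (∈-rotate⁻ {p = proj₁ z} {a} a∈) (∈-rotate⁻ {p = proj₁ z} {next a} b∈)) ec))

  balance-insert : (z : Piece) (zs : Vec Piece l) → balance (insert _≺ᵇ_ z zs) ≡ sign (proj₂ z) +ℤ balance zs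
  balance-insert z [] = blackMinusWhite-∷ (proj₂ z) []
  balance-insert z (w ∷ zs) with z ≺ᵇ w
  ... | true  = blackMinusWhite-∷ (proj₂ z) (proj₂ w ∷ Vec.map proj₂ zs)
  ... | false = begin
    balance (w ∷ insert _≺ᵇ_ z zs)                          ≡⟨ blackMinusWhite-∷ (proj₂ w) _ ⟩
    sign (proj₂ w) +ℤ balance (insert _≺ᵇ_ z zs)            ≡⟨ cong (sign (proj₂ w) +ℤ_) (balance-insert z zs) ⟩
    sign (proj₂ w) +ℤ (sign (proj₂ z) +ℤ balance zs)        ≡⟨ lem (sign (proj₂ w)) (sign (proj₂ z)) (balance zs) ⟩
    sign (proj₂ z) +ℤ (sign (proj₂ w) +ℤ balance zs)        ≡⟨ cong (sign (proj₂ z) +ℤ_) (blackMinusWhite-∷ (proj₂ w) _) ⟨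
    sign (proj₂ z) +ℤ balance (w ∷ zs)                      ∎
    where
    open ≡-Reasoning
    lem : ∀ x y u → x +ℤ (y +ℤ u) ≡ y +ℤ (x +ℤ u)
    lem = solve-∀

  balance-rotate : (zs : Vec Piece l) → balance (rotateFamily zs) ≡ balance zs
  balance-rotate []       = refl
  balance-rotate (z ∷ zs) = trans (balance-insert (rotatePiece z) (rotateFamily zs))
    (trans (cong (sign (proj₂ z) +ℤ_) (balance-rotate zs)) (sym (blackMinusWhite-∷ (proj₂ z) (Vec.map proj₂ zs))))

  -- Sorting forgets positions but keeps the entries. Hence `zs` and `ws` have the same entries, and
  -- both are strictly sorted.
  rotateFamily-injective : {zs ws : Vec Piece l} → Family zs → Family ws →
    rotateFamily zs ≡ rotateFamily ws → zs ≡ ws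
  rotateFamily-injective fz fw eq = sorted-unique
    (λ { {x} {y} (lt , _) (gt , _) → lexLt-irrefl (proj₁ x) (lexLt-trans (proj₁ x) (proj₁ y) (proj₁ x) lt gt) })
    (Family.pairs fz) (Family.pairs fw) (transfer eq) (transfer (sym eq))
    where
    transfer : ∀ {l} {zs ws : Vec Piece l} → rotateFamily zs ≡ rotateFamily ws → ∀ {z} → z ∈ⱽ zs → z ∈ⱽ ws
    transfer {zs = zs} {ws} eq {z} z∈ with find-map ws (∈-sort⁻ _≺ᵇ_ {xs = Vec.map rotatePiece ws}
        (subst (rotatePiece z ∈ⱽ_) eq (∈-sort⁺ _≺ᵇ_ {xs = Vec.map rotatePiece zs} (∈Vecₚ.∈-map⁺ rotatePiece z∈))))
      where
      find-map : ∀ {l} (vs : Vec Piece l) {u} → u ∈ⱽ Vec.map rotatePiece vs → ∃ λ v → v ∈ⱽ vs × u ≡ rotatePiece v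
      find-map (v ∷ vs) (here eq)  = v , here refl , eq
      find-map (v ∷ vs) (there u∈) with find-map vs u∈
      ... | v′ , v′∈ , eq = v′ , there v′∈ , eq
    ... | v , v∈ , eq′ = subst (_∈ⱽ ws) (sym (rotatePiece-injective eq′)) v∈

  swapPiece : Piece → Piece
  swapPiece (p , b) = p , not b

  -- The order looks at the polygons only, so recolouring requires no sorting.
  swap-family : {zs : Vec Piece l} → Family zs → Family (Vec.map swapPiece zs)
  swap-family (family ss ps) = family (VAllₚ.map⁺ ss) (VAllPairsₚ.map⁺ (VAllPairs.map
    (λ { (lt , compatible s t a pr) → lt , compatible s t a (λ e eq → pr e (not-injective eq)) }) ps))

  swap-edgeColour : {a : Fin (3 ℕ.+ m)} {col : Bool} {zs : Vec Piece l} →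
    EdgeColour a col zs → EdgeColour a (not col) (Vec.map swapPiece zs)
  swap-edgeColour ec = VAllₚ.map⁺ (VAll.map (λ e a∈ b∈ → cong not (e a∈ b∈)) ec)

  balance-swap : (zs : Vec Piece l) → balance (Vec.map swapPiece zs) ≡ -ℤ balance zs
  balance-swap [] = refl
  balance-swap ((p , b) ∷ zs) = begin
    balance (Vec.map swapPiece ((p , b) ∷ zs))          ≡⟨ blackMinusWhite-∷ (not b) _ ⟩
    sign (not b) +ℤ balance (Vec.map swapPiece zs)      ≡⟨ cong₂ _+ℤ_ (sign-not b) (balance-swap zs) ⟩
    -ℤ sign b +ℤ -ℤ balance zs                          ≡⟨ ℤₚ.neg-distrib-+ (sign b) (balance zs) ⟨
    -ℤ (sign b +ℤ balance zs)                           ≡⟨ cong -ℤ_ (blackMinusWhite-∷ b _) ⟨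
    -ℤ balance ((p , b) ∷ zs)                           ∎
    where open ≡-Reasoning

  swap-injective : {zs ws : Vec Piece l} → Vec.map swapPiece zs ≡ Vec.map swapPiece ws → zs ≡ ws
  swap-injective {zs = []}     {[]}     _  = refl
  swap-injective {zs = z ∷ zs} {w ∷ ws} eq with Vecₚ.∷-injective eq
  ... | eq₁ , eq₂ = cong₂ _∷_
    (cong₂ _,_ (cong proj₁ eq₁) (not-injective (cong proj₂ eq₁))) (swap-injective eq₂)

T-does⁺ : {P : Set} (P? : Dec P) → P → T (does P?)
T-does⁺ (yes _) _ = tt
T-does⁺ (no ¬p) p = ¬p p

T-does⁻ : {P : Set} (P? : Dec P) → T (does P?) → P
T-does⁻ (yes p) _ = p

xor⁻ : ∀ {x y} → T (x xor y) → x ≢ y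
xor⁻ {true}  {true}  ()
xor⁻ {false} {false} ()
xor⁻ {true}  {false} _ ()
xor⁻ {false} {true}  _ ()

xor⁺ : ∀ {x y} → x ≢ y → T (x xor y)
xor⁺ {true}  {true}  ne = ne refl
xor⁺ {true}  {false} ne = tt
xor⁺ {false} {true}  ne = tt
xor⁺ {false} {false} ne = ne refl

-- The values fall weakly from 0 up to the last index, and the step from there back to 0 closes the
-- chain.
cyclically-decreasing⇒constant : {M : ℕ} (f : Fin (suc M) → ℕ) → (∀ a → f (next a) ≤ f a) → ∀ a → f a ≡ f zero
cyclically-decreasing⇒constant {M} f dec a = ℕₚ.≤-antisym
  (<-weakInduction (λ a → f a ≤ f zero) ℕₚ.≤-refl (λ i le → ℕₚ.≤-trans (step i) le) a)
  (>-weakInduction (λ a → f zero ≤ f a) (subst (λ b → f b ≤ f (Fin.fromℕ M)) next-fromℕ (dec (Fin.fromℕ M)))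
    (λ i le → ℕₚ.≤-trans le (step i)) a)
  where
  step : ∀ i → f (suc i) ≤ f (Fin.inject₁ i)
  step i = subst (λ b → f b ≤ f (Fin.inject₁ i)) (next-inject₁ i) (dec (Fin.inject₁ i))

-- Enumerated candidates as coloured families

module _ (d′ n′ : ℕ) where

  private
    d n m : ℕ
    d = 2 ℕ.+ d′
    n = suc n′
    -- With this choice `nVert d n` computes to 3 + m, so the results for at least three vertices
    -- apply to candidates directly.
    m = n′ ℕ.+ d′ ℕ.* n

    Vertex : Set
    Vertex = Fin (3 ℕ.+ m)

    2≤d : 2 ≤ d
    2≤d = s≤s (s≤s z≤n)

    Fam : Vec (Subset (3 ℕ.+ m) × Bool) n → Set
    Fam = Family {m} d 2≤d

  properᵇ : Vec (Subset (nVert d n)) n → Vec Bool n → Bool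
  properᵇ ps c = all (λ ij → not (shareEdge (lookup ps (proj₁ ij)) (lookup ps (proj₂ ij)))
                     ∨ (lookup c (proj₁ ij) xor lookup c (proj₂ ij))) (pairsLt n)

  colouredᵇ : ℤ → Candidate d n → Bool
  colouredᵇ j (ps , c) = isDissection d n ps ∧ (properᵇ ps c ∧ does (blackMinusWhite c ℤ.≟ j))

  -- For `zero` and `true` this is the marked-edge test of `isCheckerboard`, as `next zero` is
  -- `suc zero`.
  edgeᵇ : Vertex → Bool → Candidate d n → Bool
  edgeᵇ a col (ps , c) = List.all
    (λ i → not ((a ∈ᵇ lookup ps i) ∧ (next a ∈ᵇ lookup ps i)) ∨ does (lookup c i Bool.≟ col)) (allFin n)

  goodᵇ : Vertex → Bool → ℤ → Candidate d n → Bool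
  goodᵇ a col j x = colouredᵇ j x ∧ edgeᵇ a col x

  pieces : Candidate d n → Vec (Subset (3 ℕ.+ m) × Bool) n
  pieces (ps , c) = Vec.zip ps c

  unpieces : Vec (Subset (3 ℕ.+ m) × Bool) n → Candidate d n
  unpieces zs = Vec.map proj₁ zs , Vec.map proj₂ zs

  coloured⁻ : ∀ {j} ps c → T (colouredᵇ j (ps , c)) →
    T (isDissection d n ps) × T (properᵇ ps c) × T (does (blackMinusWhite c ℤ.≟ j))
  coloured⁻ ps c t = proj₁ split , T-∧⁻ {properᵇ ps c} (proj₂ split)
    where split = T-∧⁻ {isDissection d n ps} t

  dissection⁻ : ∀ ps → T (isDissection d n ps) → (∀ i → ∣ lookup ps i ∣ ≡ suc d)
    × (∀ i k → toℕ i < toℕ k → T (lexLt (lookup ps i) (lookup ps k)) × NonOverlap (lookup ps i) (lookup ps k))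
  dissection⁻ ps t = (λ i → ℕₚ.≡ᵇ⇒≡ ∣ lookup ps i ∣ (suc d) (all-allFin⁻ (proj₁ split) i))
    , λ i k lt → let s = T-∧⁻ {lexLt (lookup ps i) (lookup ps k)} (all-pairsLt⁻ (proj₂ split) i k lt) in
        proj₁ s , nonOverlap⁻ {p = lookup ps i} {lookup ps k} (proj₂ s)
    where split = T-∧⁻ {all (λ i → ∣ lookup ps i ∣ ℕ.≡ᵇ suc d) (allFin n)} t

  coloured⇒family : ∀ {j} x → T (colouredᵇ j x) → Fam (pieces x)
  coloured⇒family {j} (ps , c) t = family
    (VAllₚ.lookup⁻ λ i → subst (λ z → ∣ proj₁ z ∣ ≡ suc d) (sym (Vecₚ.lookup-zip i ps c)) (size i))
    (AllPairs⁺ (Vec.zip ps c) λ i k lt → subst₂ (λ z w → T (lexLt (proj₁ z) (proj₁ w)) × Compatible d 2≤d z w)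
      (sym (Vecₚ.lookup-zip i ps c)) (sym (Vecₚ.lookup-zip k ps c)) (pair i k lt))
    where
    size : ∀ i → ∣ lookup ps i ∣ ≡ suc d
    size = proj₁ (dissection⁻ ps (proj₁ (coloured⁻ {j} ps c t)))
    pair : ∀ i k → toℕ i < toℕ k → T (lexLt (lookup ps i) (lookup ps k))
      × Compatible d 2≤d (lookup ps i , lookup c i) (lookup ps k , lookup c k)
    pair i k lt = proj₁ info , compatible (size i) (size k) (proj₂ info)
      λ e → xor⁻ (T-⇒⁻ (all-pairsLt⁻ (proj₁ (proj₂ (coloured⁻ {j} ps c t))) i k lt) (shareEdge⁺ {p = lookup ps i} {lookup ps k} e))
      where info = proj₂ (dissection⁻ ps (proj₁ (coloured⁻ {j} ps c t))) i k lt

  coloured⇒balance : ∀ {j} x → T (colouredᵇ j x) → balance d 2≤d (pieces x) ≡ j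
  coloured⇒balance {j} (ps , c) t = trans (cong blackMinusWhite (map-proj₂-zip ps c))
    (T-does⁻ (blackMinusWhite c ℤ.≟ j) (proj₂ (proj₂ (coloured⁻ {j} ps c t))))

  family⇒dissection : ∀ x → Fam (pieces x) → T (isDissection d n (proj₁ x))
  family⇒dissection (ps , c) (family ss prs) = T-∧⁺ {all (λ i → ∣ lookup ps i ∣ ℕ.≡ᵇ suc d) (allFin n)}
    (all-allFin⁺ λ i → ℕₚ.≡⇒≡ᵇ ∣ lookup ps i ∣ (suc d)
      (subst (λ z → ∣ proj₁ z ∣ ≡ suc d) (Vecₚ.lookup-zip i ps c) (VAllₚ.lookup⁺ ss i)))
    (all-pairsLt⁺ λ i k lt → case subst₂ (λ z w → T (lexLt (proj₁ z) (proj₁ w)) × Compatible d 2≤d z w)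
      (Vecₚ.lookup-zip i ps c) (Vecₚ.lookup-zip k ps c) (AllPairs⁻ prs i k lt) of
      λ { (l , cm) → T-∧⁺ {lexLt (lookup ps i) (lookup ps k)} l (nonOverlap⁺ {p = lookup ps i} {lookup ps k} (apart cm)) })

  family⇒proper : ∀ x → Fam (pieces x) → ∀ i k → toℕ i < toℕ k →
    T (not (shareEdge (lookup (proj₁ x) i) (lookup (proj₁ x) k)) ∨ (lookup (proj₂ x) i xor lookup (proj₂ x) k))
  family⇒proper (ps , c) (family ss prs) i k lt = case subst₂ (λ z w → T (lexLt (proj₁ z) (proj₁ w)) × Compatible d 2≤d z w)
      (Vecₚ.lookup-zip i ps c) (Vecₚ.lookup-zip k ps c) (AllPairs⁻ prs i k lt) of
      λ { (l , cm) → T-⇒⁺ λ t → xor⁺ (proper cm (shareEdge⁻ {p = lookup ps i} {lookup ps k} t)) }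

  family⇒coloured : ∀ {j} x → Fam (pieces x) → balance d 2≤d (pieces x) ≡ j → T (colouredᵇ j x)
  family⇒coloured {j} x@(ps , c) fam bal = T-∧⁺ {isDissection d n ps} (family⇒dissection x fam)
    (T-∧⁺ {properᵇ ps c} (all-pairsLt⁺ (family⇒proper x fam))
      (T-does⁺ (blackMinusWhite c ℤ.≟ j) (trans (cong blackMinusWhite (sym (map-proj₂-zip ps c))) bal)))

  edge⇒edgeColour : ∀ {a col} x → T (edgeᵇ a col x) → EdgeColour d 2≤d a col (pieces x)
  edge⇒edgeColour {a} {col} (ps , c) t = VAllₚ.lookup⁻ λ i →
    subst (λ z → a ∈ᵖ proj₁ z → next a ∈ᵖ proj₁ z → proj₂ z ≡ col) (sym (Vecₚ.lookup-zip i ps c))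
      λ a∈ b∈ → T-does⁻ (lookup c i Bool.≟ col) (T-⇒⁻ (all-allFin⁻ t i) (T-∧⁺ a∈ b∈))

  edgeColour⇒edge : ∀ {a col} x → EdgeColour d 2≤d a col (pieces x) → T (edgeᵇ a col x)
  edgeColour⇒edge {a} {col} (ps , c) ec = all-allFin⁺ λ i → T-⇒⁺ λ t →
    T-does⁺ (lookup c i Bool.≟ col) (subst (λ z → a ∈ᵖ proj₁ z → next a ∈ᵖ proj₁ z → proj₂ z ≡ col) (Vecₚ.lookup-zip i ps c)
      (VAllₚ.lookup⁺ ec i) (proj₁ (T-∧⁻ {a ∈ᵇ lookup ps i} t)) (proj₂ (T-∧⁻ {a ∈ᵇ lookup ps i} t)))

  good : ∀ {a col j} x → Fam (pieces x) → balance d 2≤d (pieces x) ≡ j → EdgeColour d 2≤d a col (pieces x) → T (goodᵇ a col j x)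
  good {j = j} x fam bal ec = T-∧⁺ {colouredᵇ j x} (family⇒coloured x fam bal) (edgeColour⇒edge x ec)

  count : Vertex → Bool → ℤ → ℕ
  count a col j = length (filterᵇ (goodᵇ a col j) (candidates d n))

  pieces-injective : ∀ {x y} → pieces x ≡ pieces y → x ≡ y
  pieces-injective = zip-injective

  private
    unpieces-injective : ∀ {zs ws} → unpieces zs ≡ unpieces ws → zs ≡ ws
    unpieces-injective {zs} {ws} eq = trans (sym (zip-unzip zs)) (trans (cong pieces eq) (zip-unzip ws))

    good⁻ : ∀ {a col j} x → T (goodᵇ a col j x) → T (colouredᵇ j x) × T (edgeᵇ a col x)
    good⁻ {j = j} x = T-∧⁻ {colouredᵇ j x}

  -- Vertex `next i` is relabelled `i`, so the edge from `next a` moves to the edge from `a`, while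
  -- colours and balance are kept.
  count-next : ∀ a col j → count (next a) col j ≤ count a col j
  count-next a col j = count-injection (goodᵇ (next a) col j) (goodᵇ a col j) rot
    (candidates-unique d n) (candidates-complete d n) pres inj
    where
    rot : Candidate d n → Candidate d n
    rot x = unpieces (rotateFamily d 2≤d (pieces x))
    pres : ∀ x → T (goodᵇ (next a) col j x) → T (goodᵇ a col j (rot x))
    pres x t = good (rot x) (subst Fam eq (rotate-family d 2≤d (coloured⇒family x b)))
        (trans (cong (balance d 2≤d) (sym eq)) (trans (balance-rotate d 2≤d (pieces x)) (coloured⇒balance x b)))
        (subst (EdgeColour d 2≤d a col) eq (rotate-edgeColour d 2≤d (edge⇒edgeColour x e)))
      where
      b : T (colouredᵇ j x)
      b = proj₁ (good⁻ {next a} {col} {j} x t)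
      e : T (edgeᵇ (next a) col x)
      e = proj₂ (good⁻ {next a} {col} {j} x t)
      eq : rotateFamily d 2≤d (pieces x) ≡ pieces (rot x)
      eq = sym (zip-unzip _)
    inj : ∀ x y → T (goodᵇ (next a) col j x) → T (goodᵇ (next a) col j y) → rot x ≡ rot y → x ≡ y
    inj x y s t eq = pieces-injective {x} {y} (rotateFamily-injective d 2≤d
      (coloured⇒family x (proj₁ (good⁻ {next a} {col} {j} x s))) (coloured⇒family y (proj₁ (good⁻ {next a} {col} {j} y t)))
      (unpieces-injective eq))

  count-constant : ∀ a col j → count a col j ≡ count zero col j
  count-constant a col j = cyclically-decreasing⇒constant (λ a → count a col j) (λ a → count-next a col j) a

  count-swap-≤ : ∀ a col j → count a col j ≤ count a (not col) (-ℤ j)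
  count-swap-≤ a col j = count-injection (goodᵇ a col j) (goodᵇ a (not col) (-ℤ j)) swap
    (candidates-unique d n) (candidates-complete d n) pres inj
    where
    swap : Candidate d n → Candidate d n
    swap x = unpieces (Vec.map (swapPiece d 2≤d) (pieces x))
    pres : ∀ x → T (goodᵇ a col j x) → T (goodᵇ a (not col) (-ℤ j) (swap x))
    pres x t = good (swap x) (subst Fam eq (swap-family d 2≤d (coloured⇒family x b)))
        (trans (cong (balance d 2≤d) (sym eq)) (trans (balance-swap d 2≤d (pieces x)) (cong -ℤ_ (coloured⇒balance x b))))
        (subst (EdgeColour d 2≤d a (not col)) eq (swap-edgeColour d 2≤d (edge⇒edgeColour x e)))
      where
      b : T (colouredᵇ j x)
      b = proj₁ (good⁻ {a} {col} {j} x t)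
      e : T (edgeᵇ a col x)
      e = proj₂ (good⁻ {a} {col} {j} x t)
      eq : Vec.map (swapPiece d 2≤d) (pieces x) ≡ pieces (swap x)
      eq = sym (zip-unzip _)
    inj : ∀ x y → T (goodᵇ a col j x) → T (goodᵇ a col j y) → swap x ≡ swap y → x ≡ y
    inj x y _ _ eq = pieces-injective {x} {y} (swap-injective d 2≤d (unpieces-injective eq))

  -- The reverse inequality is `count-swap-≤` for the opposite colour and balance.
  count-swap : ∀ a j → count a false j ≡ count a true (-ℤ j)
  count-swap a j = ℕₚ.≤-antisym (count-swap-≤ a false j)
    (subst (λ k → count a true (-ℤ j) ≤ count a false k) (ℤₚ.neg-involutive j) (count-swap-≤ a true (-ℤ j)))

-- Double counting of coloured boundary edges

module _ (d′ n′ : ℕ) where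

  private
    d n m : ℕ
    d = 2 ℕ.+ d′
    n = suc n′
    m = n′ ℕ.+ d′ ℕ.* n

    Vertex : Set
    Vertex = Fin (3 ℕ.+ m)

    good-indicator : Vertex → Bool → ℤ → Candidate d n → ℤ
    good-indicator a col j x = indicator (goodᵇ d′ n′ a col j x)

  module _ (ps : Vec (Subset (nVert d n)) n) (c : Vec Bool n) (j : ℤ) (base : T (colouredᵇ d′ n′ j (ps , c))) where

    private
      sizes : ∀ i → ∣ lookup ps i ∣ ≡ 2 ℕ.+ suc d′
      sizes = proj₁ (dissection⁻ d′ n′ ps (proj₁ (coloured⁻ d′ n′ {j} ps c base)))

      apart-< : ∀ i k → toℕ i < toℕ k → NonOverlap (lookup ps i) (lookup ps k)
      apart-< i k lt = proj₂ (proj₂ (dissection⁻ d′ n′ ps (proj₁ (coloured⁻ d′ n′ {j} ps c base))) i k lt)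

      apart-≢ : ∀ i k → i ≢ k → NonOverlap (lookup ps i) (lookup ps k)
      apart-≢ i k i≢k with ℕₚ.<-cmp (toℕ i) (toℕ k)
      ... | tri< lt _ _ = apart-< i k lt
      ... | tri≈ _ eq _ = contradiction (Finₚ.toℕ-injective eq) i≢k
      ... | tri> _ _ gt = nonOverlap-sym {p = lookup ps k} {lookup ps i} (subst (2 ≤_) (sym (sizes i)) (s≤s (s≤s z≤n))) (apart-< k i gt)

      proper-< : ∀ i k → toℕ i < toℕ k → ShareEdge (lookup ps i) (lookup ps k) → lookup c i ≢ lookup c k
      proper-< i k lt e = xor⁻ (T-⇒⁻ (all-pairsLt⁻ (proj₁ (proj₂ (coloured⁻ d′ n′ {j} ps c base))) i k lt)
        (shareEdge⁺ {p = lookup ps i} {lookup ps k} e))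

      proper-≢ : ∀ i k → i ≢ k → ShareEdge (lookup ps i) (lookup ps k) → lookup c i ≢ lookup c k
      proper-≢ i k i≢k e with ℕₚ.<-cmp (toℕ i) (toℕ k)
      ... | tri< lt _ _ = proper-< i k lt e
      ... | tri≈ _ eq _ = contradiction (Finₚ.toℕ-injective eq) i≢k
      ... | tri> _ _ gt = proper-< k i gt (shareEdge-sym {p = lookup ps i} {lookup ps k} e) ∘ sym

      full : 3 ℕ.+ m ≡ 2 ℕ.+ n ℕ.* suc d′
      full = cong (2 ℕ.+_) (ℕₚ.*-comm (suc d′) n)

      edge-polygon : (a : Vertex) → ∃ λ i → Side (lookup ps i) a (next a)
      edge-polygon = edge-covered (lookup ps) (suc d′) (s≤s z≤n) sizes apart-≢ full

      flow′ : Vertex → Vertex → ℤ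
      flow′ = flow (lookup ps) (suc d′) (s≤s z≤n) sizes apart-≢ full (lookup c) proper-≢

    -- `p i` is the only polygon containing both ends of the edge, so the test over all polygons
    -- reduces to its colour.
    good-edge : ∀ a col i → Side (lookup ps i) a (next a) →
      good-indicator a col j (ps , c) ≡ indicator (does (lookup c i Bool.≟ col))
    good-edge a col i s with lookup c i Bool.≟ col
    ... | yes eq = indicator-true (T-∧⁺ {colouredᵇ d′ n′ j (ps , c)} base (all-allFin⁺ λ k → T-⇒⁺ λ t →
          T-does⁺ (lookup c k Bool.≟ col) (trans (cong (lookup c) (same k t)) eq)))
      where
      same : ∀ k → T ((a ∈ᵇ lookup ps k) ∧ (next a ∈ᵇ lookup ps k)) → k ≡ i
      same k t = same-side (lookup ps) (suc d′) (s≤s z≤n) sizes apart-≢ full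
        (next-end (proj₁ (T-∧⁻ {a ∈ᵇ lookup ps k} t)) (proj₂ (T-∧⁻ {a ∈ᵇ lookup ps k} t))) s
    ... | no ne = indicator-false λ t → ne (T-does⁻ (lookup c i Bool.≟ col)
          (T-⇒⁻ (all-allFin⁻ (proj₂ (T-∧⁻ {colouredᵇ d′ n′ j (ps , c)} t)) i) (T-∧⁺ (start∈ s) (end∈ s))))

    good-sum : ∀ a → good-indicator a true j (ps , c) +ℤ good-indicator a false j (ps , c) ≡ 1ℤ
    good-sum a = trans (cong₂ _+ℤ_ (good-edge a true i s) (good-edge a false i s)) (cases (lookup c i))
      where
      i = proj₁ (edge-polygon a)
      s = proj₂ (edge-polygon a)
      cases : ∀ b → indicator (does (b Bool.≟ true)) +ℤ indicator (does (b Bool.≟ false)) ≡ 1ℤ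
      cases true  = refl
      cases false = refl

    good-difference : ∀ a → good-indicator a true j (ps , c) -ℤ good-indicator a false j (ps , c) ≡ flow′ a (next a)
    good-difference a = trans (cong₂ _-ℤ_ (good-edge a true i s) (good-edge a false i s))
      (trans (cases (lookup c i))
        (sym (flow-side (lookup ps) (suc d′) (s≤s z≤n) sizes apart-≢ full (lookup c) proper-≢ s)))
      where
      i = proj₁ (edge-polygon a)
      s = proj₂ (edge-polygon a)
      cases : ∀ b → indicator (does (b Bool.≟ true)) -ℤ indicator (does (b Bool.≟ false)) ≡ sign b
      cases true  = refl
      cases false = refl

    ∑-good-difference :
      ∑ (allFin (3 ℕ.+ m)) (λ a → good-indicator a true j (ps , c) -ℤ good-indicator a false j (ps , c)) ≡ + suc d *ℤ j
    ∑-good-difference = begin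
      ∑ (allFin (3 ℕ.+ m)) (λ a → good-indicator a true j (ps , c) -ℤ good-indicator a false j (ps , c))
        ≡⟨ ∑-cong (allFin (3 ℕ.+ m)) good-difference ⟩
      ∑ (allFin (3 ℕ.+ m)) (λ a → flow′ a (next a))
        ≡⟨ ∑-boundary-flow (lookup ps) (suc d′) (s≤s z≤n) sizes apart-≢ full (lookup c) proper-≢ ⟩
      + suc d *ℤ ∑ (allFin n) (sign ∘ lookup c)
        ≡⟨ cong (+ suc d *ℤ_) (blackMinusWhite-∑ c) ⟨
      + suc d *ℤ blackMinusWhite c
        ≡⟨ cong (+ suc d *ℤ_) (T-does⁻ (blackMinusWhite c ℤ.≟ j) (proj₂ (proj₂ (coloured⁻ d′ n′ {j} ps c base)))) ⟩
      + suc d *ℤ j ∎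
      where open ≡-Reasoning

  private
    not-good : ∀ a col j x → ¬ T (colouredᵇ d′ n′ j x) → good-indicator a col j x ≡ 0ℤ
    not-good a col j x ¬base = indicator-false (¬base ∘ proj₁ ∘ T-∧⁻ {colouredᵇ d′ n′ j x})

  -- The last factor is the indicator of a properly coloured dissection of balance `j`, written as
  -- black plus white at the marked edge so that its sum over candidates consists of the counts
  -- sought. For any other candidate both sides vanish.
  edges-vs-balance : ∀ j x →
    ∑ (allFin (3 ℕ.+ m)) (λ a → good-indicator a true j x -ℤ good-indicator a false j x)
      ≡ (+ suc d *ℤ j) *ℤ (good-indicator zero true j x +ℤ good-indicator zero false j x)
  edges-vs-balance j x@(ps , c) = by-cases (T? (colouredᵇ d′ n′ j x))
    where
    by-cases : Dec (T (colouredᵇ d′ n′ j x)) → _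
    by-cases (yes base) = trans (∑-good-difference ps c j base)
      (sym (trans (cong ((+ suc d *ℤ j) *ℤ_) (good-sum ps c j base zero)) (ℤₚ.*-identityʳ _)))
    by-cases (no ¬base) = trans
      (∑-zero (allFin (3 ℕ.+ m)) λ a → cong₂ _-ℤ_ (not-good a true j x ¬base) (not-good a false j x ¬base))
      (sym (trans (cong ((+ suc d *ℤ j) *ℤ_) (cong₂ _+ℤ_ (not-good zero true j x ¬base) (not-good zero false j x ¬base)))
        (ℤₚ.*-zeroʳ (+ suc d *ℤ j))))

  private
    X : Vertex → Bool → ℤ → ℤ
    X a col j = + count d′ n′ a col j

    X-∑ : ∀ a col j → X a col j ≡ ∑ (candidates d n) (good-indicator a col j)
    X-∑ a col j = length-filterᵇ (goodᵇ d′ n′ a col j) (candidates d n)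

  -- Both sides count the black minus the white boundary edges of all
  -- properly coloured dissections of balance j.
  boundary-count : ∀ j → + (3 ℕ.+ m) *ℤ (X zero true j -ℤ X zero false j)
    ≡ (+ suc d *ℤ j) *ℤ (X zero true j +ℤ X zero false j)
  boundary-count j = begin
    + (3 ℕ.+ m) *ℤ (X zero true j -ℤ X zero false j)
      ≡⟨ cong (λ l → + l *ℤ (X zero true j -ℤ X zero false j)) (Listₚ.length-tabulate {n = 3 ℕ.+ m} id) ⟨
    + length V *ℤ (X zero true j -ℤ X zero false j)
      ≡⟨ ∑-const V (X zero true j -ℤ X zero false j) ⟨
    ∑ V (λ a → X zero true j -ℤ X zero false j)
      ≡⟨ ∑-cong V (λ a → cong₂ (λ k l → + k -ℤ + l) (sym (count-constant d′ n′ a true j)) (sym (count-constant d′ n′ a false j))) ⟩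
    ∑ V (λ a → X a true j -ℤ X a false j)
      ≡⟨ ∑-cong V (λ a → trans (cong₂ _-ℤ_ (X-∑ a true j) (X-∑ a false j)) (∑-difference a)) ⟩
    ∑ V (λ a → ∑ C (λ x → good-indicator a true j x -ℤ good-indicator a false j x))
      ≡⟨ ∑-swap V C (λ a x → good-indicator a true j x -ℤ good-indicator a false j x) ⟩
    ∑ C (λ x → ∑ V (λ a → good-indicator a true j x -ℤ good-indicator a false j x))
      ≡⟨ ∑-cong C (edges-vs-balance j) ⟩
    ∑ C (λ x → (+ suc d *ℤ j) *ℤ (good-indicator zero true j x +ℤ good-indicator zero false j x))
      ≡⟨ ∑-*ˡ C (+ suc d *ℤ j) (λ x → good-indicator zero true j x +ℤ good-indicator zero false j x) ⟩
    (+ suc d *ℤ j) *ℤ ∑ C (λ x → good-indicator zero true j x +ℤ good-indicator zero false j x)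
      ≡⟨ cong ((+ suc d *ℤ j) *ℤ_) (∑-+ C (good-indicator zero true j) (good-indicator zero false j)) ⟩
    (+ suc d *ℤ j) *ℤ (∑ C (good-indicator zero true j) +ℤ ∑ C (good-indicator zero false j))
      ≡⟨ cong ((+ suc d *ℤ j) *ℤ_) (cong₂ _+ℤ_ (X-∑ zero true j) (X-∑ zero false j)) ⟨
    (+ suc d *ℤ j) *ℤ (X zero true j +ℤ X zero false j) ∎
    where
    open ≡-Reasoning
    V : List Vertex
    V = allFin (3 ℕ.+ m)
    C : List (Candidate d n)
    C = candidates d n
    ∑-difference : ∀ a → ∑ C (good-indicator a true j) -ℤ ∑ C (good-indicator a false j)
      ≡ ∑ C (λ x → good-indicator a true j x -ℤ good-indicator a false j x)
    ∑-difference a = sym (trans (∑-+ C (good-indicator a true j) (λ x → -ℤ good-indicator a false j x))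
      (cong (∑ C (good-indicator a true j) +ℤ_) (∑-neg C (good-indicator a false j))))

  -- Both filters test the same conditions in a different arrangement, so the identity is an
  -- injection in each direction.
  coeff-count : ∀ j → coeff d n j ≡ count d′ n′ zero true j
  coeff-count j = ℕₚ.≤-antisym
    (count-injection _ (goodᵇ d′ n′ zero true j) id (candidates-unique d n) (candidates-complete d n)
      (λ { (ps , c) → to ps c }) (λ _ _ _ _ → id))
    (count-injection (goodᵇ d′ n′ zero true j) _ id (candidates-unique d n) (candidates-complete d n)
      (λ { (ps , c) → from ps c }) (λ _ _ _ _ → id))
    where
    marked⁺ : ∀ {b e} → T (not b ∨ e) → T (not b ∨ does (e Bool.≟ true))
    marked⁺ {b} {e} t = T-⇒⁺ {b} λ s → T-does⁺ (e Bool.≟ true) (Equivalence.to T-≡ (T-⇒⁻ t s))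
    marked⁻ : ∀ {b e} → T (not b ∨ does (e Bool.≟ true)) → T (not b ∨ e)
    marked⁻ {b} {e} t = T-⇒⁺ {b} λ s → Equivalence.from T-≡ (T-does⁻ (e Bool.≟ true) (T-⇒⁻ t s))
    to : ∀ ps c → T (isDissection d n ps ∧ isCheckerboard d n ps c ∧ does (blackMinusWhite c ℤ.≟ j)) →
      T (goodᵇ d′ n′ zero true j (ps , c))
    to ps c t = T-∧⁺ {colouredᵇ d′ n′ j (ps , c)}
      (T-∧⁺ {isDissection d n ps} (proj₁ t₁) (T-∧⁺ {properᵇ d′ n′ ps c}
        -- The two pair tests are written as different functions but agree on every pair, so the
        -- proof passes through the pointwise statement.
        (all-pairsLt⁺ {n} (all-pairsLt⁻ {n} (proj₂ t₃))) (proj₂ t₂)))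
      (all-allFin⁺ λ i → marked⁺ {containsMarked (lookup ps i)} (all-allFin⁻ (proj₁ t₃) i))
      where
      t₁ = T-∧⁻ {isDissection d n ps} t
      t₂ = T-∧⁻ {isCheckerboard d n ps c} (proj₂ t₁)
      t₃ = T-∧⁻ {all (λ i → not (containsMarked (lookup ps i)) ∨ lookup c i) (allFin n)} (proj₁ t₂)
    from : ∀ ps c → T (goodᵇ d′ n′ zero true j (ps , c)) →
      T (isDissection d n ps ∧ isCheckerboard d n ps c ∧ does (blackMinusWhite c ℤ.≟ j))
    from ps c t = T-∧⁺ {isDissection d n ps} (proj₁ t₂) (T-∧⁺ {isCheckerboard d n ps c}
      (T-∧⁺ {all (λ i → not (containsMarked (lookup ps i)) ∨ lookup c i) (allFin n)}
        (all-allFin⁺ λ i → marked⁻ {containsMarked (lookup ps i)} (all-allFin⁻ (proj₂ t₁) i))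
        (all-pairsLt⁺ {n} (all-pairsLt⁻ {n} (proj₁ (proj₂ t₂)))))
      (proj₂ (proj₂ t₂)))
      where
      t₁ = T-∧⁻ {colouredᵇ d′ n′ j (ps , c)} t
      t₂ = coloured⁻ d′ n′ {j} ps c (proj₁ t₁)

  -- In `boundary-count` the white count at balance `j` is the black count at `- j`, hence the other
  -- coefficient.
  coeff-symmetry : ∀ j → (+ nVert d n +ℤ + suc d *ℤ j) *ℤ + coeff d n (-ℤ j)
    ≡ (+ nVert d n -ℤ + suc d *ℤ j) *ℤ + coeff d n j
  coeff-symmetry j = rearrange (+ nVert d n) (+ suc d *ℤ j) (+ coeff d n j) (+ coeff d n (-ℤ j))
    (subst₂ (λ x y → + nVert d n *ℤ (+ x -ℤ + y) ≡ (+ suc d *ℤ j) *ℤ (+ x +ℤ + y))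
      (sym (coeff-count j)) (trans (count-swap d′ n′ zero j) (sym (coeff-count (-ℤ j)))) (boundary-count j))
    where
    rearrange : ∀ N D x y → N *ℤ (x -ℤ y) ≡ D *ℤ (x +ℤ y) → (N +ℤ D) *ℤ y ≡ (N -ℤ D) *ℤ x
    rearrange N D x y eq = begin
      (N +ℤ D) *ℤ y                                        ≡⟨ left N D x y ⟩
      -- The added bracket is the difference of the two sides of `eq`.
      (N -ℤ D) *ℤ x +ℤ (D *ℤ (x +ℤ y) -ℤ N *ℤ (x -ℤ y))   ≡⟨ cong (λ u → (N -ℤ D) *ℤ x +ℤ (D *ℤ (x +ℤ y) -ℤ u)) eq ⟩
      (N -ℤ D) *ℤ x +ℤ (D *ℤ (x +ℤ y) -ℤ D *ℤ (x +ℤ y))   ≡⟨ right N D x y ⟩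
      (N -ℤ D) *ℤ x ∎
      where
      open ≡-Reasoning
      left : ∀ N D x y → (N +ℤ D) *ℤ y ≡ (N -ℤ D) *ℤ x +ℤ (D *ℤ (x +ℤ y) -ℤ N *ℤ (x -ℤ y))
      left = solve-∀
      right : ∀ N D x y → (N -ℤ D) *ℤ x +ℤ (D *ℤ (x +ℤ y) -ℤ D *ℤ (x +ℤ y)) ≡ (N -ℤ D) *ℤ x
      right = solve-∀

theorem3p3 : (d : ℕ) → 2 ≤ d → (n : ℕ) → (j : ℤ) →
    ((+ nVert d n) + (+ suc d) * j) * (+ coeff d n (- j))
    ≡ ((+ nVert d n) - (+ suc d) * j) * (+ coeff d n j)
theorem3p3 (suc (suc d′)) (s≤s (s≤s z≤n)) (suc n′) j = coeff-symmetry d′ n′ j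
-- The polygon degenerates to two vertices and only the empty dissection of balance 0 remains. At j
-- = 0 both coefficients are 1 and the linear factors agree; otherwise both coefficients are 0.
theorem3p3 (suc (suc d′)) (s≤s (s≤s z≤n)) zero j = no-polygons j
  where
  d = suc (suc d′)
  no-polygons : ∀ j → (+ nVert d 0 + + suc d * j) * + coeff d 0 (- j) ≡ (+ nVert d 0 - + suc d * j) * + coeff d 0 j
  no-polygons (+ zero)     = cong (_* + 1) (cong (λ t → + nVert d 0 + t) (trans (ℤₚ.*-zeroʳ (+ suc d)) (cong -_ (sym (ℤₚ.*-zeroʳ (+ suc d))))))
  no-polygons (+ suc k)    = trans (ℤₚ.*-zeroʳ (+ nVert d 0 + + suc d * + suc k)) (sym (ℤₚ.*-zeroʳ (+ nVert d 0 - + suc d * + suc k)))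
  no-polygons ℤ.-[1+ k ]   = trans (ℤₚ.*-zeroʳ (+ nVert d 0 + + suc d * ℤ.-[1+ k ])) (sym (ℤₚ.*-zeroʳ (+ nVert d 0 - + suc d * ℤ.-[1+ k ])))
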